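{- For all $k\ge 1$, $$I^1_{12\dots k}(x)=\frac{1}{U_k\left(\frac{1}{2x}\right)},$$ where $I^1_{12\dots k}(x)=\sum_{n\ge 0}I^1_{12\dots k}(n)x^n$ and $I^1_{12\dots k}(n)$ is the number of involutions in $S_n$ that avoid $132$ and contain $12\dots k$ exactly once.
   Context: $S_n$ is the set of permutations of $\{1,\dots,n\}$. An occurrence of a pattern $\tau\in S_k$ in $\alpha\in S_n$ is a choice of indices $1\le i_1<\dots<i_k\le n$ such that $(\alpha_{i_1},\dots,\alpha_{i_k})$ is order-isomorphic to $\tau$; $\alpha$ avoids $\tau$ if it has no occurrence, and contains $\tau$ exactly once if it has exactly one occurrence. An involution is a permutation equal to its own inverse. $U_r$ denotes the Chebyshev polynomial of the second kind, $U_r(\cos\theta)=\sin((r+1)\theta)/\sin\theta$. The identity is one of rational functions, expanded as power series in $x$. -}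

module Defs where

open import Algebra.Bundles using (CommutativeRing)
open import Algebra.Bundles.Raw using (RawRing)
import Algebra.Properties.Ring as RingProperties
import Algebra.Properties.Semiring.Sum as SemiringSum
import Algebra.Solver.Ring.NaturalCoefficients.Default as NaturalSolver
open import Data.Fin.Base using (Fin; zero; suc; toℕ; punchIn; _<_)
open import Data.Fin.Patterns using (1F; 2F)
open import Data.Fin.Permutation
  using (Permutation′; _⟨$⟩ʳ_; flip; id; insert; remove; transpose;
         insert-remove)
  renaming (_≈_ to _≈ₚ_)
open import Data.Fin.Properties using (_≟_; _<?_; all?; punchIn-injective)
open import Data.Integer.Base as ℤ using (ℤ; +_; -[1+_])
open import Data.List.Base using (List; []; _∷_; length; filter; allFin; cartesianProductWith)
open import Data.List.Membership.Propositional.Properties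
  using (∈-allFin; ∈-cartesianProductWith⁺)
import Data.List.Membership.Setoid.Properties as SetoidMembershipₚ
import Data.List.Relation.Unary.AllPairs.Core as AllPairs
open import Data.List.Relation.Unary.All as All using ()
open import Data.List.Relation.Unary.Any using (here)
open import Data.List.Relation.Unary.Enumerates.Setoid using (IsEnumeration)
open import Data.List.Relation.Unary.Unique.Propositional using (Unique)
import Data.List.Relation.Unary.Unique.Propositional.Properties as Uniqueₚ
import Data.List.Relation.Unary.Unique.Setoid as SetoidUnique
import Data.List.Relation.Unary.Unique.Setoid.Properties as SetoidUniqueₚ
open import Data.Nat.Base as ℕ using (ℕ; zero; suc; _∸_)
import Data.Nat.Properties as ℕₚ
open import Data.Product.Base using (_×_; _,_; proj₁; proj₂)
open import Data.Rational.Base as ℚ using (ℚ; 0ℚ; 1ℚ; ½)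
import Data.Rational.Properties as ℚₚ
open import Data.Vec.Base as Vec using (Vec; []; _∷_; lookup)
open import Data.Vec.Properties using (∷-injective)
open import Function.Base using (_⟨_⟩_)
open import Function.Bundles using (_⇔_; mk⇔; Equivalence)
open import Level using (0ℓ)
open import Relation.Binary.Bundles using (Setoid)
open import Relation.Binary.PropositionalEquality using (_≡_; refl; sym; trans; cong; setoid)
open import Relation.Nullary using (Dec)
open import Relation.Nullary.Decidable using (_×-dec_; _→-dec_; map′)
import Relation.Binary.Reasoning.Setoid as SetoidReasoning

-- S_n is `Permutation′ n`: positions and values are numbered from 0.
-- Every permutation of suc n is obtained exactly once by choosing the image j
-- of the first position and a permutation of the rest.
permutations : (n : ℕ) → List (Permutation′ n)
permutations zero    = id ∷ []
permutations (suc n) = cartesianProductWith (insert zero) (allFin (suc n)) (permutations n)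

tuples : (n k : ℕ) → List (Vec (Fin n) k)
tuples n zero    = [] ∷ []
tuples n (suc k) = cartesianProductWith _∷_ (allFin n) (tuples n k)

Increasing : ∀ {n k} → Vec (Fin n) k → Set
Increasing is = ∀ a b → a < b → lookup is a < lookup is b

OrderIsomorphic : ∀ {m n k} → (Fin k → Fin m) → (Fin k → Fin n) → Set
OrderIsomorphic f g = ∀ a b → f a < f b ⇔ g a < g b

Occurrence : ∀ {k n} → Permutation′ k → Permutation′ n → Vec (Fin n) k → Set
Occurrence τ α is = Increasing is × OrderIsomorphic (λ a → α ⟨$⟩ʳ lookup is a) (τ ⟨$⟩ʳ_)

occurrence? : ∀ {k n} (τ : Permutation′ k) (α : Permutation′ n) (is : Vec (Fin n) k) →
              Dec (Occurrence τ α is)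
occurrence? τ α is =
  (all? λ a → all? λ b → (a <? b) →-dec (lookup is a <? lookup is b))
  ×-dec
  (all? λ a → all? λ b →
     let P? = (α ⟨$⟩ʳ lookup is a) <? (α ⟨$⟩ʳ lookup is b)
         Q? = (τ ⟨$⟩ʳ a) <? (τ ⟨$⟩ʳ b)
     in map′ (λ (f , g) → mk⇔ f g)
             (λ e → Equivalence.to e , Equivalence.from e)
             ((P? →-dec Q?) ×-dec (Q? →-dec P?)))

#occurrences : ∀ {k n} → Permutation′ k → Permutation′ n → ℕ
#occurrences {k} {n} τ α = length (filter (occurrence? τ α) (tuples n k))

Avoids : ∀ {k n} → Permutation′ n → Permutation′ k → Set
Avoids α τ = #occurrences τ α ≡ 0

ContainsExactlyOnce : ∀ {k n} → Permutation′ n → Permutation′ k → Set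
ContainsExactlyOnce α τ = #occurrences τ α ≡ 1

Involution : ∀ {n} → Permutation′ n → Set
Involution α = α ≈ₚ flip α

pattern132 : Permutation′ 3
pattern132 = transpose 1F 2F

pattern12⋯ : (k : ℕ) → Permutation′ k
pattern12⋯ k = id

Counted : (k : ℕ) {n : ℕ} → Permutation′ n → Set
Counted k α = Involution α × Avoids α pattern132 × ContainsExactlyOnce α (pattern12⋯ k)

counted? : (k : ℕ) {n : ℕ} (α : Permutation′ n) → Dec (Counted k α)
counted? k α =
  (all? λ i → (α ⟨$⟩ʳ i) ≟ (flip α ⟨$⟩ʳ i))
  ×-dec (#occurrences pattern132 α ℕₚ.≟ 0)
  ×-dec (#occurrences (pattern12⋯ k) α ℕₚ.≟ 1)

I¹ : (k n : ℕ) → ℕ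
I¹ k n = length (filter (counted? k) (permutations n))

tuples-complete : ∀ n k → IsEnumeration (setoid (Vec (Fin n) k)) (tuples n k)
tuples-complete n zero    []       = here refl
tuples-complete n (suc k) (i ∷ is) =
  ∈-cartesianProductWith⁺ _∷_ (∈-allFin i) (tuples-complete n k is)

tuples-unique : ∀ n k → Unique (tuples n k)
tuples-unique n zero    = All.[] AllPairs.∷ AllPairs.[]
tuples-unique n (suc k) =
  Uniqueₚ.cartesianProductWith⁺ _∷_ ∷-injective (Uniqueₚ.allFin⁺ n) (tuples-unique n k)

permutationSetoid : ℕ → Setoid 0ℓ 0ℓ
permutationSetoid n = record
  { Carrier       = Permutation′ n
  ; _≈_           = _≈ₚ_
  ; isEquivalence = record
    { refl  = λ _ → refl
    ; sym   = λ p i → sym (p i)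
    ; trans = λ p q i → trans (p i) (q i)
    }
  }

private
  insert-cong : ∀ {n} {j j′ : Fin (suc n)} {π π′ : Permutation′ n} →
                j ≡ j′ → π ≈ₚ π′ → insert zero j π ≈ₚ insert zero j′ π′
  insert-cong refl p zero    = refl
  insert-cong {j = j} refl p (suc i) = cong (punchIn j) (p i)

  insert-injective : ∀ {n} {j j′ : Fin (suc n)} {π π′ : Permutation′ n} →
                     insert zero j π ≈ₚ insert zero j′ π′ → j ≡ j′ × π ≈ₚ π′
  insert-injective {j = j} p with p zero
  ... | refl = refl , λ i → punchIn-injective j _ _ (p (suc i))

permutations-complete : ∀ n → IsEnumeration (permutationSetoid n) (permutations n)
permutations-complete zero    π = here λ ()
permutations-complete (suc n) π =
  SetoidMembershipₚ.∈-resp-≈ (permutationSetoid (suc n))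
    {x = insert zero (π ⟨$⟩ʳ zero) (remove zero π)} {π} (insert-remove zero π)
    (SetoidMembershipₚ.∈-cartesianProductWith⁺
      (setoid (Fin (suc n))) (permutationSetoid n) (permutationSetoid (suc n))
      (λ {j} {j′} {ρ} {ρ′} → insert-cong {π = ρ} {ρ′})
      (∈-allFin (π ⟨$⟩ʳ zero)) (permutations-complete n (remove zero π)))

permutations-unique : ∀ n → SetoidUnique.Unique (permutationSetoid n) (permutations n)
permutations-unique zero    = All.[] AllPairs.∷ AllPairs.[]
permutations-unique (suc n) =
  SetoidUniqueₚ.cartesianProductWith⁺
    (setoid (Fin (suc n))) (permutationSetoid n) (permutationSetoid (suc n))
    (insert zero) (λ {j} {j′} {ρ} {ρ′} → insert-injective {π = ρ} {ρ′})
    (Uniqueₚ.allFin⁺ (suc n)) (permutations-unique n)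

-- U_r has integer coefficients, so it can be evaluated at an element of any ring.
module _ {c ℓ} (R : RawRing c ℓ) where
  open RawRing R

  chebyshevU : ℕ → Carrier → Carrier
  chebyshevU zero          t = 1#
  chebyshevU (suc zero)    t = (1# + 1#) * t
  chebyshevU (suc (suc r)) t = ((1# + 1#) * t) * chebyshevU (suc r) t + - chebyshevU r t

-- U_r(cos θ) · sin θ = sin ((r+1)θ), where the only facts used about sine and
-- cosine are cos² θ + sin² θ = 1 and the angle addition formulas.
module _ {c ℓ} (R : CommutativeRing c ℓ) where
  open CommutativeRing R

  module _ (cosθ sinθ : Carrier) where

    mutual
      cosMultiple : ℕ → Carrier
      cosMultiple zero    = 1#
      cosMultiple (suc n) = cosMultiple n * cosθ + - (sinMultiple n * sinθ)

      sinMultiple : ℕ → Carrier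
      sinMultiple zero    = 0#
      sinMultiple (suc n) = sinMultiple n * cosθ + cosMultiple n * sinθ

    private
      open NaturalSolver commutativeSemiring using (solve; con; _:=_; _:+_; _:*_)
      open SetoidReasoning (CommutativeRing.setoid R)
      open RingProperties ring using (-‿distribˡ-*)

      two : Carrier
      two = 1# + 1#

      -- sin ((n+2)θ) = 2 cos θ · sin ((n+1)θ) - sin (nθ)
      sin-recurrence : cosθ * cosθ + sinθ * sinθ ≈ 1# → ∀ n →
        (two * cosθ) * sinMultiple (suc n) + - sinMultiple n ≈ sinMultiple (suc (suc n))
      sin-recurrence pyth n = begin
        (two * cosθ) * S₁ + d
          ≈⟨ +-congˡ (trans′ (sym′ (*-identityʳ d)) (*-congˡ (sym′ pyth))) ⟩
        (two * cosθ) * S₁ + d * (cosθ * cosθ + sinθ * sinθ)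
          ≈⟨ solve 5 (λ c s S C d →
               ((con 1 :+ con 1) :* c) :* (S :* c :+ C :* s) :+ d :* (c :* c :+ s :* s)
               := ((S :* c :+ C :* s) :* c :+ (C :* c :+ d :* s) :* s) :+ (S :+ d) :* (c :* c))
               refl′ cosθ sinθ S C d ⟩
        (S₁ * cosθ + (C * cosθ + d * sinθ) * sinθ) + (S + d) * (cosθ * cosθ)
          ≈⟨ +-congˡ (trans′ (*-congʳ (-‿inverseʳ S)) (zeroˡ _)) ⟩
        (S₁ * cosθ + (C * cosθ + d * sinθ) * sinθ) + 0#
          ≈⟨ +-identityʳ _ ⟩
        S₁ * cosθ + (C * cosθ + d * sinθ) * sinθ
          ≈⟨ +-congˡ (*-congʳ (+-congˡ (sym′ (-‿distribˡ-* S sinθ)))) ⟩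
        sinMultiple (suc (suc n)) ∎
        where
        open CommutativeRing R using () renaming (refl to refl′; sym to sym′; trans to trans′)
        S  = sinMultiple n
        C  = cosMultiple n
        S₁ = sinMultiple (suc n)
        d  = - S

    chebyshevU-sin : cosθ * cosθ + sinθ * sinθ ≈ 1# →
                     ∀ r → chebyshevU rawRing r cosθ * sinθ ≈ sinMultiple (suc r)
    chebyshevU-sin pyth zero =
      solve 2 (λ c s → con 1 :* s := con 0 :* c :+ con 1 :* s)
        (CommutativeRing.refl R) cosθ sinθ
    chebyshevU-sin pyth (suc zero) =
      solve 2 (λ c s → ((con 1 :+ con 1) :* c) :* s
                       := (con 0 :* c :+ con 1 :* s) :* c :+ (con 1 :* c :+ con 0) :* s)
        (CommutativeRing.refl R) cosθ sinθ
      ⟨ CommutativeRing.trans R ⟩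
      +-congˡ (*-congʳ (+-congˡ (begin
        0#            ≈⟨ -0#≈0# ⟨
        - 0#          ≈⟨ -‿cong (zeroˡ sinθ) ⟨
        - (0# * sinθ) ∎)))
      where open RingProperties ring using (-0#≈0#)
    chebyshevU-sin pyth (suc (suc r)) = begin
      ((two * cosθ) * U₁ + - U₀) * sinθ
        ≈⟨ distribʳ sinθ _ _ ⟩
      ((two * cosθ) * U₁) * sinθ + - U₀ * sinθ
        ≈⟨ +-cong (*-assoc _ _ _) (CommutativeRing.sym R (-‿distribˡ-* U₀ sinθ)) ⟩
      (two * cosθ) * (U₁ * sinθ) + - (U₀ * sinθ)
        ≈⟨ +-cong (*-congˡ (chebyshevU-sin pyth (suc r))) (-‿cong (chebyshevU-sin pyth r)) ⟩
      (two * cosθ) * sinMultiple (suc (suc r)) + - sinMultiple (suc r)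
        ≈⟨ sin-recurrence pyth (suc r) ⟩
      sinMultiple (suc (suc (suc r))) ∎
      where
      U₀ = chebyshevU rawRing r cosθ
      U₁ = chebyshevU rawRing (suc r) cosθ

open SemiringSum (CommutativeRing.semiring ℚₚ.+-*-commutativeRing) using (sum)

PowerSeries : Set
PowerSeries = ℕ → ℚ

-- x^m · f
shift : ℕ → PowerSeries → PowerSeries
shift zero    f n       = f n
shift (suc m) f zero    = 0ℚ
shift (suc m) f (suc n) = shift m f n

_⋆_ : PowerSeries → PowerSeries → PowerSeries
(f ⋆ g) n = sum {suc n} λ i → f (toℕ i) ℚ.* g (n ∸ toℕ i)

constant : ℚ → PowerSeries
constant q zero    = q
constant q (suc n) = 0ℚ

-- x^-⟨ p ⟩ f stands for x^(-p) · f; the representation is not unique.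
record LaurentSeries : Set where
  constructor x^-⟨_⟩_
  field
    pole   : ℕ
    series : PowerSeries

open LaurentSeries

coefficient : LaurentSeries → ℤ → ℚ
coefficient F i with i ℤ.+ + pole F
... | + n      = series F n
... | -[1+ _ ] = 0ℚ

laurentRawRing : RawRing 0ℓ 0ℓ
laurentRawRing = record
  { Carrier = LaurentSeries
  ; _≈_     = λ F G → ∀ i → coefficient F i ≡ coefficient G i
  ; _+_     = λ (x^-⟨ p ⟩ f) (x^-⟨ q ⟩ g) →
                x^-⟨ p ℕ.+ q ⟩ λ n → shift q f n ℚ.+ shift p g n
  ; _*_     = λ (x^-⟨ p ⟩ f) (x^-⟨ q ⟩ g) → x^-⟨ p ℕ.+ q ⟩ (f ⋆ g)
  ; -_      = λ (x^-⟨ p ⟩ f) → x^-⟨ p ⟩ λ n → ℚ.- f n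
  ; 0#      = x^-⟨ 0 ⟩ constant 0ℚ
  ; 1#      = x^-⟨ 0 ⟩ constant 1ℚ
  }

module Laurent = RawRing laurentRawRing

fromPowerSeries : PowerSeries → LaurentSeries
fromPowerSeries f = x^-⟨ 0 ⟩ f

-- F = 1/G in the field of Laurent series
_≈1/_ : LaurentSeries → LaurentSeries → Set
F ≈1/ G = F Laurent.* G Laurent.≈ Laurent.1#

1/2x : LaurentSeries
1/2x = x^-⟨ 1 ⟩ constant ½

I¹-series : ℕ → PowerSeries
I¹-series k n = + I¹ k n ℚ./ 1

{-# OPTIONS --safe #-}
module Submission where

-- A 132-avoiding involution α of {0,…,n-1} is produced by a stack machine: start with the
-- interval [0,n) and an empty stack; an up step moves the right end r of the interval onto
-- the stack, a down step pops the top f of the stack and matches it with the left end l: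
-- α l = f and α f = l.  Points left on the stack are fixed.  This is a bijection with the
-- walks of n steps ±1 that start at 0 and stay nonnegative.  The stacks that occur are,
-- up to inclusion and α ↔ α⁻¹, exactly the increasing subsequences of α, so 12…k occurs
-- exactly once iff the walk reaches height k at its last step and not before.
--
-- Let g h be the generating function of the walks from h that first reach k at the end.
-- Then g 0 = x · g 1, g (h+1) = x · (g (h+2) + g h) and g k = 1, so the recurrence of the
-- Chebyshev polynomials at 1/(2x) gives g h = U_h(1/(2x)) · g 0, and h = k is the theorem.

open import Defs
open import Data.Empty using (⊥; ⊥-elim)
open import Data.Fin.Base as Fin using (Fin; zero; suc; toℕ; fromℕ<)
open import Data.Fin.Patterns using (0F; 1F; 2F)
open import Data.Fin.Permutation
  using (Permutation′; _⟨$⟩ʳ_; _⟨$⟩ˡ_; permutation; inverseˡ; inverseʳ)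
import Data.Fin.Properties as Fin
open import Data.Integer.Base as ℤ using (+_; -[1+_])
import Data.Integer.Properties as ℤ
open import Data.List.Base using (List; []; _∷_; length; map; _++_; take; filter)
open import Data.List.Membership.Propositional using (_∈_; find)
open import Data.List.Membership.Propositional.Properties
  using (∈-map⁺; ∈-map⁻; ∈-++⁺ˡ; ∈-++⁺ʳ; ∈-filter⁺; ∈-filter⁻)
import Data.List.Membership.Setoid as SetoidMembership
open import Data.List.Properties
  using (length-map; length-++; length-take; length-removeAt′; ∷-injective; filter-none)
open import Data.List.Relation.Unary.All as All using (All; []; _∷_)
import Data.List.Relation.Unary.All.Properties as All
open import Data.List.Relation.Unary.AllPairs as AllPairs using (AllPairs; []; _∷_)
import Data.List.Relation.Unary.AllPairs.Properties as AllPairs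
open import Data.List.Relation.Unary.Any using (here; there; index; _─_)
open import Data.List.Relation.Unary.Unique.Propositional using (Unique)
import Data.List.Relation.Unary.Unique.Propositional.Properties as Unique
open import Data.Nat.Base
open import Data.Nat.Properties
open import Data.Product.Base using (∃; _×_; _,_; proj₁; proj₂)
open import Data.Rational.Base as ℚ using (0ℚ; 1ℚ; ½)
import Data.Rational.Properties as ℚ
open import Data.Rational.Solver using (module +-*-Solver)
import Data.Rational.Unnormalised.Base as ℚᵘ
import Data.Rational.Unnormalised.Properties as ℚᵘ
open import Data.Sum.Base using (_⊎_; inj₁; inj₂)
open import Data.Vec.Base using (Vec; []; _∷_; lookup)
open import Function.Base using (_∘_; id)
open import Function.Bundles using (_⇔_; mk⇔; Equivalence)
open import Relation.Binary.Definitions using (tri<; tri≈; tri>)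
open import Relation.Binary.PropositionalEquality
open import Relation.Nullary using (¬_; Dec; yes; no; contradiction)
open import Relation.Unary using (Decidable)

open LaurentSeries

-- Counting by separating relations, and sorted lists

∈-─ : ∀ {A : Set} {x y : A} {ys} (y∈ys : y ∈ ys) → x ≢ y → x ∈ ys → x ∈ (ys ─ y∈ys)
∈-─ (here refl)  x≢y (here refl)  = contradiction refl x≢y
∈-─ (here refl)  x≢y (there x∈ys) = x∈ys
∈-─ (there y∈ys) x≢y (here refl)  = here refl
∈-─ (there y∈ys) x≢y (there x∈ys) = there (∈-─ y∈ys x≢y x∈ys)

-- Pigeonhole: the partner of the first element can be deleted from `ys`, because separation keeps
-- every later element from sharing it. Distinctness is a relation `D` of its own so as to cover
-- `_<_`, `_≢_` and pointwise inequality of permutations.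
length-≤-separating : ∀ {A B : Set} {D : A → A → Set} (R : A → B → Set) →
  (∀ {x x′ y} → D x x′ → R x y → ¬ R x′ y) →
  ∀ {xs} → AllPairs D xs → ∀ {ys} → (∀ {x} → x ∈ xs → ∃ λ y → y ∈ ys × R x y) →
  length xs ≤ length ys
length-≤-separating R sep []                 related = z≤n
length-≤-separating R sep (x-new ∷ distinct) {ys} related
  with y , y∈ys , xRy ← related (here refl) =
  subst (_ ≤_) (sym (length-removeAt′ ys (index y∈ys)))
    (s≤s (length-≤-separating R sep distinct λ x′∈xs →
      let y′ , y′∈ys , x′Ry′ = related (there x′∈xs)
      in y′ , ∈-─ y∈ys (λ { refl → sep (All.lookup x-new x′∈xs) xRy x′Ry′ }) y′∈ys , x′Ry′))

Sorted : List ℕ → Set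
Sorted = AllPairs _<_

sorted-⊆-length : ∀ {xs ys} → Sorted xs → (∀ {x} → x ∈ xs → x ∈ ys) → length xs ≤ length ys
sorted-⊆-length sorted xs⊆ys =
  length-≤-separating _≡_ (λ { x<x′ refl refl → <-irrefl refl x<x′ }) sorted
    (λ x∈xs → _ , xs⊆ys x∈xs , refl)

sorted-⊆-≡ : ∀ {xs ys} → Sorted xs → Sorted ys → (∀ {x} → x ∈ xs → x ∈ ys) →
             length xs ≡ length ys → xs ≡ ys
sorted-⊆-≡ []              []               _     _  = refl
sorted-⊆-≡ {xs = x ∷ xs} {ys = y ∷ ys} (x<xs ∷ sortedˣ) (y<ys ∷ sortedʸ) xs⊆ys eq with xs⊆ys (here refl)
... | here refl = cong (x ∷_) (sorted-⊆-≡ sortedˣ sortedʸ tail⊆ (suc-injective eq))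
  where
  tail⊆ : ∀ {z} → z ∈ xs → z ∈ ys
  tail⊆ z∈xs with xs⊆ys (there z∈xs)
  ... | here refl  = contradiction (All.lookup x<xs z∈xs) (<-irrefl refl)
  ... | there z∈ys = z∈ys
-- If `x` sits in the tail then `y < x`, so all of `x ∷ xs` lies in `ys`, which is too short.
... | there x∈ys =
  contradiction (sorted-⊆-length (x<xs ∷ sortedˣ) into-tail) (<⇒≱ (≤-reflexive (sym eq)))
  where
  into-tail : ∀ {z} → z ∈ x ∷ xs → z ∈ ys
  into-tail (here refl) = x∈ys
  into-tail (there z∈xs) with xs⊆ys (there z∈xs)
  ... | here refl  =
    contradiction (<-trans (All.lookup x<xs z∈xs) (All.lookup y<ys x∈ys)) (<-irrefl refl)
  ... | there z∈ys = z∈ys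

-- Walks and the stack machine

-- h is the current height and h + d the height at which the walk stops on its first visit.
data Walk : ℕ → ℕ → ℕ → Set where
  stop : ∀ {h} → Walk h 0 0
  up   : ∀ {h d n} → Walk (suc h) d n → Walk h (suc d) (suc n)
  down : ∀ {h d n} → Walk h (suc (suc d)) n → Walk (suc h) (suc d) (suc n)

walks : ∀ h d n → List (Walk h d n)
walks h       zero    zero    = stop ∷ []
walks h       zero    (suc n) = []
walks h       (suc d) zero    = []
walks zero    (suc d) (suc n) = map up (walks 1 d n)
walks (suc h) (suc d) (suc n) =
  map up (walks (suc (suc h)) d n) ++ map down (walks h (suc (suc d)) n)

walks-complete : ∀ {h d n} (w : Walk h d n) → w ∈ walks h d n
walks-complete stop                 = here refl
walks-complete {zero}  (up w)       = ∈-map⁺ up (walks-complete w)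
walks-complete {suc h} (up w)       = ∈-++⁺ˡ (∈-map⁺ up (walks-complete w))
walks-complete {suc h} {suc d} {suc n} (down w) =
  ∈-++⁺ʳ (map up (walks (suc (suc h)) d n)) (∈-map⁺ down (walks-complete w))

up-injective : ∀ {h d n} {w w′ : Walk (suc h) d n} → up w ≡ up w′ → w ≡ w′
up-injective refl = refl

down-injective : ∀ {h d n} {w w′ : Walk h (suc (suc d)) n} → down w ≡ down w′ → w ≡ w′
down-injective refl = refl

walks-unique : ∀ h d n → Unique (walks h d n)
walks-unique h       zero    zero    = [] ∷ []
walks-unique h       zero    (suc n) = []
walks-unique h       (suc d) zero    = []
walks-unique zero    (suc d) (suc n) = Unique.map⁺ up-injective (walks-unique 1 d n)
walks-unique (suc h) (suc d) (suc n) =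
  Unique.++⁺ (Unique.map⁺ up-injective (walks-unique (suc (suc h)) d n))
             (Unique.map⁺ down-injective (walks-unique h (suc (suc d)) n))
             λ (∈up , ∈down) → up≢down (∈-map⁻ up ∈up) (∈-map⁻ down ∈down)
  where
  up≢down : ∀ {v : Walk (suc h) (suc d) (suc n)} →
            (∃ λ w → w ∈ walks (suc (suc h)) d n × v ≡ up w) →
            (∃ λ w → w ∈ walks h (suc (suc d)) n × v ≡ down w) → ⊥
  up≢down (_ , _ , refl) (_ , _ , ())

-- The unread interval is [l,r), and s lists the stack from its top, in increasing order.
data Run (α : ℕ → ℕ) : (l r : ℕ) (s : List ℕ) {d n : ℕ} → Walk (length s) d n → Set where
  stop : ∀ {l s} → All (λ x → α x ≡ x) s → Run α l l s stop
  up   : ∀ {l r s d n} {w : Walk (suc (length s)) d n} →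
         Run α l r (r ∷ s) w → Run α l (suc r) s (up w)
  down : ∀ {l r f s d n} {w : Walk (length s) (suc (suc d)) n} →
         α l ≡ f → α f ≡ l → Run α (suc l) r s w → Run α l r (f ∷ s) (down w)

-- The points whose images the rest of the run decides. The bound `l ≤ x` covers stack entries too,
-- so an active image gives a lower bound at once.
Active : ℕ → ℕ → List ℕ → ℕ → Set
Active l r s x = l ≤ x × (x < r ⊎ x ∈ s)

Stack : ℕ → List ℕ → Set
Stack r s = Sorted s × All (r ≤_) s

stack-up : ∀ {r s} → Stack (suc r) s → Stack r (r ∷ s)
stack-up (sorted , r<s) = (r<s ∷ sorted) , (≤-refl ∷ All.map <⇒≤ r<s)

stack-down : ∀ {r f s} → Stack r (f ∷ s) → Stack r s
stack-down ((_ ∷ sorted) , (_ ∷ r≤s)) = sorted , r≤s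

active-up : ∀ {l r s x} → Active l (suc r) s x → Active l r (r ∷ s) x
active-up (l≤x , inj₂ x∈s) = l≤x , inj₂ (there x∈s)
active-up (l≤x , inj₁ (s≤s x≤r)) with m≤n⇒m<n∨m≡n x≤r
... | inj₁ x<r  = l≤x , inj₁ x<r
... | inj₂ refl = l≤x , inj₂ (here refl)

active-up⁻ : ∀ {l r s x} → Active l r (r ∷ s) x → Active l (suc r) s x
active-up⁻ (l≤x , inj₁ x<r)          = l≤x , inj₁ (m<n⇒m<1+n x<r)
active-up⁻ (l≤x , inj₂ (here refl))  = l≤x , inj₁ (n<1+n _)
active-up⁻ (l≤x , inj₂ (there x∈s)) = l≤x , inj₂ x∈s

data DownView (l r f : ℕ) (s : List ℕ) (x : ℕ) : Set where
  bottom : x ≡ l → DownView l r f s x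
  partner : x ≡ f → DownView l r f s x
  other  : Active (suc l) r s x → DownView l r f s x

active-down : ∀ {l r f s x} → Active l r (f ∷ s) x → DownView l r f s x
active-down (l≤x , p) with m≤n⇒m<n∨m≡n l≤x
... | inj₂ refl = bottom refl
active-down (l≤x , inj₁ x<r)         | inj₁ l<x = other (l<x , inj₁ x<r)
active-down (l≤x , inj₂ (here x≡f))  | inj₁ l<x = partner x≡f
active-down (l≤x , inj₂ (there x∈s)) | inj₁ l<x = other (l<x , inj₂ x∈s)

active-down⁻ : ∀ {l r f s x} → Active (suc l) r s x → Active l r (f ∷ s) x
active-down⁻ (l<x , inj₁ x<r) = <⇒≤ l<x , inj₁ x<r
active-down⁻ (l<x , inj₂ x∈s) = <⇒≤ l<x , inj₂ (there x∈s)

active-down-≢ : ∀ {l r f s x} → Stack r (f ∷ s) → Active (suc l) r s x → x ≢ f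
active-down-≢ (_ , r≤f ∷ _) (_ , inj₁ x<r) refl = <⇒≱ x<r r≤f
active-down-≢ ((f<s ∷ _) , _) (_ , inj₂ x∈s) refl = <-irrefl refl (All.lookup f<s x∈s)

active-stop : ∀ {l s x} → Active l l s x → x ∈ s
active-stop (l≤x , inj₁ x<l) = contradiction l≤x (<⇒≱ x<l)
active-stop (l≤x , inj₂ x∈s) = x∈s

run-≤ : ∀ {α l r s d n} {w : Walk (length s) d n} → Run α l r s w → l ≤ r
run-≤ (stop _)     = ≤-refl
run-≤ (up run)     = m≤n⇒m≤1+n (run-≤ run)
run-≤ (down _ _ run) = <⇒≤ (run-≤ run)

run-≢ : ∀ {α l r f s d n} {w : Walk (length s) d n} → Stack r (f ∷ s) → Run α (suc l) r s w → l ≢ f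
run-≢ (_ , r≤f ∷ _) run refl = <⇒≱ (run-≤ run) r≤f

Step : (ℕ → ℕ) → ℕ → ℕ → Set
Step α x y = x < y × α x < α y

module _ {α : ℕ → ℕ} where

  -- A down step exchanges two active points, an up step leaves the active set unchanged, and the
  -- stop fixes what is left.
  run-closed : ∀ {l r s d n} {w : Walk (length s) d n} → Stack r s → Run α l r s w →
               ∀ {x} → Active l r s x → Active l r s (α x)
  run-closed st (stop fixed) {x} a = subst (Active _ _ _) (sym (All.lookup fixed (active-stop a))) a
  run-closed st (up run) a = active-up⁻ (run-closed (stack-up st) run (active-up a))
  run-closed st (down αl≡f αf≡l run) a with active-down a
  ... | bottom refl = subst (Active _ _ _) (sym αl≡f)
                        (≤-trans (<⇒≤ (run-≤ run)) (All.head (proj₂ st)) , inj₂ (here refl))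
  ... | partner refl    = subst (Active _ _ _) (sym αf≡l) (≤-refl , inj₁ (run-≤ run))
  ... | other a′    = active-down⁻ (run-closed (stack-down st) run a′)

  run-involutive : ∀ {l r s d n} {w : Walk (length s) d n} → Run α l r s w →
                   ∀ {x} → Active l r s x → α (α x) ≡ x
  run-involutive (stop fixed) a = trans (cong α αx≡x) αx≡x
    where αx≡x = All.lookup fixed (active-stop a)
  run-involutive (up run) a = run-involutive run (active-up a)
  run-involutive (down αl≡f αf≡l run) a with active-down a
  ... | bottom refl = trans (cong α αl≡f) αf≡l
  ... | partner refl    = trans (cong α αf≡l) αl≡f
  ... | other a′    = run-involutive run a′

  run-lower : ∀ {l r s d n} {w : Walk (length s) d n} → Stack r s → Run α l r s w →
              All (λ y → l ≤ α y) s
  run-lower st run =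
    All.tabulate λ y∈s →
      proj₁ (run-closed st run
        (≤-trans (run-≤ run) (All.lookup (proj₂ st) y∈s) , inj₂ y∈s))

  fixed-chain : ∀ {xs} → Sorted xs → All (λ x → α x ≡ x) xs → AllPairs (Step α) xs
  fixed-chain [] [] = []
  fixed-chain (x<xs ∷ sorted) (αx≡x ∷ fixed) =
    All.zipWith (λ (x<y , αy≡y) → x<y , subst₂ _<_ (sym αx≡x) (sym αy≡y) x<y) (x<xs , fixed)
    ∷ fixed-chain sorted fixed

  -- A down step sends `f` to `l`, while the remaining stack has its images from `suc l` on. At an
  -- up step the claim is inherited from the longer stack.
  run-chain : ∀ {l r s d n} {w : Walk (length s) d n} → Stack r s → Run α l r s w →
              AllPairs (Step α) s
  run-chain (sorted , _) (stop fixed) = fixed-chain sorted fixed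
  run-chain st (up run) = AllPairs.tail (run-chain (stack-up st) run)
  run-chain st (down αl≡f αf≡l run) =
    All.zipWith (λ (f<y , l<αy) → f<y , subst (_< _) (sym αf≡l) l<αy)
      (AllPairs.head (proj₁ st) , run-lower (stack-down st) run)
    ∷ run-chain (stack-down st) run

  -- After pushing r the chain property gives l ≤ α r < α f.
  up≢down : ∀ {l r f s d n} {w : Walk (length (r ∷ f ∷ s)) d n} → Stack (suc r) (f ∷ s) →
            Run α l r (r ∷ f ∷ s) w → α f ≢ l
  up≢down st run αf≡l with run-lower (stack-up st) run | run-chain (stack-up st) run
  ... | l≤αr ∷ _ | ((_ , αr<αf) ∷ _) ∷ _ = <⇒≱ αr<αf (subst (_≤ _) (sym αf≡l) l≤αr)

  -- On a nonempty stack with top `f` the next step is forced: it is down exactly when `α f ≡ l`.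
  run-unique : ∀ {l r s d n} {w w′ : Walk (length s) d n} → Stack r s →
               Run α l r s w → Run α l r s w′ → w ≡ w′
  run-unique st (stop _) (stop _) = refl
  run-unique st (up run) (up run′) = cong up (run-unique (stack-up st) run run′)
  run-unique st (up run) (down _ αf≡l _) = contradiction αf≡l (up≢down st run)
  run-unique st (down _ αf≡l _) (up run) = contradiction αf≡l (up≢down st run)
  run-unique st (down _ _ run) (down _ _ run′) = cong down (run-unique (stack-down st) run run′)

run-agree : ∀ {α β l r s d n} {w : Walk (length s) d n} → Run α l r s w → Run β l r s w →
            ∀ {x} → Active l r s x → α x ≡ β x
run-agree (stop fixed) (stop fixed′) a =
  trans (All.lookup fixed (active-stop a)) (sym (All.lookup fixed′ (active-stop a)))
run-agree (up run) (up run′) a = run-agree run run′ (active-up a)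
run-agree (down αl αf run) (down βl βf run′) a with active-down a
... | bottom refl = trans αl (sym βl)
... | partner refl    = trans αf (sym βf)
... | other a′    = run-agree run run′ a′

run-cong : ∀ {α β l r s d n} {w : Walk (length s) d n} → Stack r s →
           (∀ {x} → Active l r s x → α x ≡ β x) → Run α l r s w → Run β l r s w
run-cong st α≗β (stop fixed) = stop (All.tabulate λ x∈s →
  trans (sym (α≗β (All.lookup (proj₂ st) x∈s , inj₂ x∈s))) (All.lookup fixed x∈s))
run-cong st α≗β (up run) = up (run-cong (stack-up st) (α≗β ∘ active-up⁻) run)
run-cong st α≗β (down αl αf run) =
  down (trans (sym (α≗β (≤-refl , inj₁ (run-≤ run)))) αl)
       (trans (sym (α≗β (≤-trans (<⇒≤ (run-≤ run)) (All.head (proj₂ st)) , inj₂ (here refl)))) αf)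
       (run-cong (stack-down st) (α≗β ∘ active-down⁻) run)

-- The right end has the form `n + l`, so an up step shortens the interval by computation; a down
-- step moves `l` instead and needs `+-suc`. There the function of the shorter run is overridden at
-- `l` and `f`, neither of which is active in that run. The stack is split before the walk so that
-- `length s` reduces.
run-exists : ∀ {d n} l s (w : Walk (length s) d n) → Stack (n + l) s → ∃ λ α → Run α l (n + l) s w
run-exists l []         stop   st = id , stop []
run-exists l s@(_ ∷ _) stop   st = id , stop (All.tabulate λ _ → refl)
run-exists l []         (up w) st with run-exists l (_ ∷ []) w (stack-up st)
... | α , run = α , up run
run-exists l s@(_ ∷ _) (up w) st with run-exists l (_ ∷ s) w (stack-up st)
... | α , run = α , up run
run-exists {n = suc n} l (f ∷ s) (down w) st = β , down (β-l refl) (β-f refl) run-β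
  where
  st′ : Stack (suc (n + l)) s
  st′ = stack-down st
  IH : ∃ λ α → Run α (suc l) (suc (n + l)) s w
  IH = subst (λ r → ∃ λ α → Run α (suc l) r s w) (+-suc n l)
         (run-exists (suc l) s w (subst (λ r → Stack r s) (sym (+-suc n l)) st′))
  β : ℕ → ℕ
  β x with x ≟ l | x ≟ f
  ... | yes _ | _     = f
  ... | no  _ | yes _ = l
  ... | no  _ | no  _ = proj₁ IH x
  β-l : ∀ {x} → x ≡ l → β x ≡ f
  β-l {x} x≡l with x ≟ l | x ≟ f
  ... | yes _  | _ = refl
  ... | no x≢l | _ = contradiction x≡l x≢l
  β-f : ∀ {x} → x ≡ f → β x ≡ l
  β-f {x} x≡f with x ≟ l | x ≟ f
  ... | yes x≡l | _      = contradiction (trans (sym x≡l) x≡f) (run-≢ st (proj₂ IH))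
  ... | no _    | yes _  = refl
  ... | no _    | no x≢f = contradiction x≡f x≢f
  β-other : ∀ {x} → x ≢ l → x ≢ f → proj₁ IH x ≡ β x
  β-other {x} x≢l x≢f with x ≟ l | x ≟ f
  ... | yes x≡l | _       = contradiction x≡l x≢l
  ... | no _    | yes x≡f = contradiction x≡f x≢f
  ... | no _    | no _    = refl
  run-β : Run β (suc l) (suc (n + l)) s w
  run-β = run-cong st′ (λ a → β-other (>⇒≢ (proj₁ a)) (active-down-≢ st a)) (proj₂ IH)

-- Pattern avoidance and longest chains of a run

module _ {α : ℕ → ℕ} where

  chain-monotone : ∀ {s x y} → AllPairs (Step α) s → x ∈ s → y ∈ s → x < y → α x < α y
  chain-monotone (_ ∷ _)      (here refl) (here refl) x<y = contradiction x<y (<-irrefl refl)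
  chain-monotone (steps ∷ _)  (here refl) (there y∈s) _   = proj₂ (All.lookup steps y∈s)
  chain-monotone (steps ∷ _)  (there x∈s) (here refl) x<y =
    contradiction (proj₁ (All.lookup steps x∈s)) (<-asym x<y)
  chain-monotone (_ ∷ chain) (there x∈s) (there y∈s) x<y = chain-monotone chain x∈s y∈s x<y

  active-≥top : ∀ {l r f s x} → Stack r (f ∷ s) → Active l r (f ∷ s) x → f < x → x ∈ f ∷ s
  active-≥top (_ , r≤f ∷ _) (_ , inj₁ x<r) f<x = contradiction r≤f (<⇒≱ (<-trans f<x x<r))
  active-≥top _             (_ , inj₂ x∈s) _   = x∈s

  -- Induction along the run: only a down step removes points, so it remains to exclude a 132 that
  -- uses `l` or `f`.
  run-avoids : ∀ {l r s d n} {w : Walk (length s) d n} → Stack r s → Run α l r s w →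
    ∀ {i j k} → Active l r s i → Active l r s j → Active l r s k →
    i < j → j < k → α i < α k → ¬ (α k < α j)
  run-avoids st run@(stop fixed) ai aj ak i<j j<k _ αk<αj =
    <-asym (chain-monotone (run-chain st run) (active-stop aj) (active-stop ak) j<k) αk<αj
  run-avoids st (up run) ai aj ak =
    run-avoids (stack-up st) run (active-up ai) (active-up aj) (active-up ak)
  run-avoids st run₀@(down αl≡f αf≡l run) ai aj ak i<j j<k αi<αk αk<αj with active-down ai
  -- With `i = l` and `α l = f`, both `α k` and `α j` exceed `f` and so lie on the stack. As `α`
  -- increases there and is an involution on active points, `α k < α j` gives `k < j`.
  ... | bottom refl =
    <-asym j<k (subst₂ _<_ (run-involutive run₀ ak) (run-involutive run₀ aj)
      (chain-monotone (run-chain st run₀)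
        (active-≥top st (run-closed st run₀ ak) f<αk)
        (active-≥top st (run-closed st run₀ aj) (<-trans f<αk αk<αj)) αk<αj))
    where f<αk = subst (_< _) αl≡f αi<αk
  -- With `i = f`, both `j` and `k` lie on the stack, where `α` increases.
  ... | partner refl =
    <-asym (chain-monotone (run-chain st run₀) (active-≥top st aj i<j)
             (active-≥top st ak (<-trans i<j j<k)) j<k) αk<αj
  ... | other ai′ with active-down aj | active-down ak
  ...   | bottom refl | _           = <⇒≱ i<j (<⇒≤ (proj₁ ai′))
  ...   | _           | bottom refl = <⇒≱ (<-trans i<j j<k) (<⇒≤ (proj₁ ai′))
  -- `f` has the least active image `l`, so it can be neither the 3 nor the 2 of a 132.
  ...   | partner refl    | _           =
    <⇒≱ (subst (_ <_) αf≡l (<-trans αi<αk αk<αj)) (proj₁ (run-closed st run₀ ai))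
  ...   | _           | partner refl    =
    <⇒≱ (subst (_ <_) αf≡l αi<αk) (proj₁ (run-closed st run₀ ai))
  ...   | other aj′   | other ak′   =
    run-avoids (stack-down st) run ai′ aj′ ak′ i<j j<k αi<αk αk<αj

  chain-sorted : ∀ {s} → AllPairs (Step α) s → Sorted s
  chain-sorted = AllPairs.map proj₁

  -- The stack left at the end of the run is the only chain of deficiencies and
  -- fixed points that has h + d elements.
  run-final : ∀ {l r s d n} {w : Walk (length s) d n} → Stack r s → Run α l r s w →
    ∃ λ final → Sorted final × All (λ x → Active l r s x × α x ≡ x) final ×
    length final ≡ length s + d ×
    (∀ {ys} → AllPairs (Step α) ys → All (λ y → Active l r s y × α y ≤ y) ys →
     length ys ≡ length s + d → ys ≡ final)
  run-final {s = s} st (stop fixed) =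
    s , proj₁ st ,
    All.tabulate (λ x∈s → (All.lookup (proj₂ st) x∈s , inj₂ x∈s) , All.lookup fixed x∈s) ,
    sym (+-identityʳ _) ,
    -- At a stop only the stack is active, so a chain of the same length equals it.
    λ chain weak eq → sorted-⊆-≡ (chain-sorted chain) (proj₁ st)
      (λ y∈ys → active-stop (proj₁ (All.lookup weak y∈ys))) (trans eq (+-identityʳ _))
  run-final {s = s} {d = suc d} st (up run) with run-final (stack-up st) run
  ... | final , sorted , fixed , eq , maximal =
    final , sorted , All.map (λ (a , αx≡x) → active-up⁻ a , αx≡x) fixed ,
    trans eq (sym (+-suc _ d)) ,
    λ chain weak eq′ → maximal chain (All.map (λ (a , αx≤x) → active-up a , αx≤x) weak)
      (trans eq′ (+-suc _ d))
  run-final {l} {r} {f ∷ s} {d = suc d} st run₀@(down αl≡f αf≡l run) with run-final (stack-down st) run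
  ... | final , sorted , fixed , eq , maximal =
    final , sorted , All.map (λ (a , αx≡x) → active-down⁻ a , αx≡x) fixed ,
    trans eq (+-suc _ (suc d)) ,
    λ chain weak eq′ →
      maximal chain (All.tabulate λ y∈ys → remains chain weak eq′ y∈ys (All.lookup weak y∈ys))
        (trans eq′ (sym (+-suc _ (suc d))))
    where
    l<f : l < f
    l<f = ≤-trans (run-≤ run) (All.head (proj₂ st))
    module _ {ys} (chain : AllPairs (Step α) ys) (weak : All (λ y → Active l r (f ∷ s) y × α y ≤ y) ys)
             (eq′ : length ys ≡ length (f ∷ s) + suc d) where
      -- f has the least image l, so a chain through f lies on the stack and is too short.
      f∉ys : ¬ (f ∈ ys)
      f∉ys f∈ys = <⇒≱ (subst (length (f ∷ s) <_) (sym eq′) (m<m+n _ z<s))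
        (sorted-⊆-length (chain-sorted chain) on-stack)
        where
        on-stack : ∀ {y} → y ∈ ys → y ∈ f ∷ s
        on-stack {y} y∈ys with <-cmp f y
        ... | tri< f<y _ _  = active-≥top st (proj₁ (All.lookup weak y∈ys)) f<y
        ... | tri≈ _ refl _ = here refl
        ... | tri> _ _ y<f  =
          contradiction (proj₁ (run-closed st run₀ (proj₁ (All.lookup weak y∈ys))))
            (<⇒≱ (subst (_ <_) αf≡l (chain-monotone chain y∈ys f∈ys y<f)))
      remains : ∀ {y} → y ∈ ys → Active l r (f ∷ s) y × α y ≤ y → Active (suc l) r s y × α y ≤ y
      remains y∈ys (a , αy≤y) with active-down a
      -- `α l = f` exceeds `l`, so `l` is a strict excedance and cannot occur in `ys`.
      ... | bottom refl = contradiction (subst (_≤ l) αl≡f αy≤y) (<⇒≱ l<f)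
      ... | partner refl    = contradiction y∈ys f∉ys
      ... | other a′    = a′ , αy≤y

-- Increasing subsequences of 132-avoiding involutions

Avoids132 : (ℕ → ℕ) → Set
Avoids132 α = ∀ {i j k} → i < j → j < k → α i < α k → ¬ (α k < α j)

Chain : (ℕ → ℕ) → ℕ → List ℕ → Set
Chain α n xs = AllPairs (Step α) xs × All (_< n) xs

-- A single occurrence of 12...k, given by its positions. For `k = 0` the empty list always
-- qualifies, so only positive lengths restrict `α`.
UniqueChain : (ℕ → ℕ) → ℕ → ℕ → List ℕ → Set
UniqueChain α n k xs = Chain α n xs × length xs ≡ k × (∀ {ys} → Chain α n ys → length ys ≡ k → ys ≡ xs)

module _ {α : ℕ → ℕ} {n : ℕ} (α² : ∀ x → α (α x) ≡ x) (α< : ∀ {x} → x < n → α x < n) where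

  -- In an involution the positions and the values of an increasing subsequence can trade places.
  chain-map : ∀ {xs} → Chain α n xs → Chain α n (map α xs)
  chain-map (chain , xs<n) =
    AllPairs.map⁺ (AllPairs.map
      (λ {x} {y} (x<y , αx<αy) → αx<αy , subst₂ _<_ (sym (α² x)) (sym (α² y)) x<y) chain) ,
    All.map⁺ (All.map α< xs<n)

  module _ (avoids : Avoids132 α) where

    -- Otherwise the positions `a < b < α b` carry the values `α a`, `α b`, `b`, which form a 132.
    no-consecutive-2-cycles : ∀ {a b} → a < α a → α a < b → ¬ (b < α b)
    no-consecutive-2-cycles {a} {b} a<αa αa<b b<αb =
      avoids (<-trans a<αa αa<b) b<αb (subst (α a <_) (sym (α² b)) αa<b)
        (subst (_< α b) (sym (α² b)) b<αb)

    -- If both were in one chain, their 2-cycles would lie one entirely before the other: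
    -- `x < α x < α y < y` or `α y < y < x < α x`.
    excedance-deficiency : ∀ {x y} → x < α x → α y < y → ¬ (Step α x y ⊎ Step α y x)
    excedance-deficiency {x} {y} x<αx αy<y (inj₁ (_ , αx<αy)) =
      no-consecutive-2-cycles x<αx αx<αy (subst (α y <_) (sym (α² y)) αy<y)
    excedance-deficiency {x} {y} x<αx αy<y (inj₂ (y<x , _)) =
      no-consecutive-2-cycles (subst (α y <_) (sym (α² y)) αy<y) (subst (_< x) (sym (α² y)) y<x) x<αx

    chain-one-sided : ∀ {xs} → AllPairs (Step α) xs →
                      All (λ x → α x ≤ x) xs ⊎ All (λ x → x ≤ α x) xs
    chain-one-sided {xs} chain with All.all? (λ x → α x ≤? x) xs
    ... | yes weak = inj₁ weak
    ... | no ¬weak with find (All.¬All⇒Any¬ (λ x → α x ≤? x) xs ¬weak)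
    ...   | x , x∈xs , αx≰x = inj₂ (All.tabulate λ {y} y∈xs → ≮⇒≥ λ αy<y →
              excedance-deficiency (≰⇒> αx≰x) αy<y
                (comparable chain x∈xs y∈xs λ { refl → αx≰x (<⇒≤ αy<y) }))
      where
      comparable : ∀ {s x y} → AllPairs (Step α) s → x ∈ s → y ∈ s → x ≢ y → Step α x y ⊎ Step α y x
      comparable (_ ∷ _)     (here refl) (here refl) x≢y = contradiction refl x≢y
      comparable (steps ∷ _) (here refl) (there y∈s) _   = inj₁ (All.lookup steps y∈s)
      comparable (steps ∷ _) (there x∈s) (here refl) _   = inj₂ (All.lookup steps x∈s)
      comparable (_ ∷ chain) (there x∈s) (there y∈s) x≢y = comparable chain x∈s y∈s x≢y

  -- A chain of weak deficiencies is `final` by `run-final`. A chain of weak excedances becomes one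
  -- of weak deficiencies under `α`, and `α` fixes `final` pointwise, so it is `final` as well.
  run⇒unique-chain : Avoids132 α → ∀ {k} {w : Walk 0 k n} → Run α 0 n [] w → ∃ (UniqueChain α n k)
  run⇒unique-chain avoids {k} run with run-final ([] , []) run
  ... | final , sorted , fixed , eq , maximal =
    final , (chain-fixed , All.map bound fixed) , eq , unique
    where
    bound : ∀ {x} → Active 0 n [] x × α x ≡ x → x < n
    bound ((_ , inj₁ x<n) , _) = x<n
    chain-fixed : AllPairs (Step α) final
    chain-fixed = fixed-chain sorted (All.map proj₂ fixed)
    weak-unique : ∀ {ys} → Chain α n ys → All (λ y → α y ≤ y) ys → length ys ≡ k → ys ≡ final
    weak-unique (chain , ys<n) weak =
      maximal chain (All.zipWith (λ (y<n , αy≤y) → (z≤n , inj₁ y<n) , αy≤y) (ys<n , weak))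
    map-fixed : ∀ {xs} → All (λ x → α x ≡ x) xs → map α xs ≡ xs
    map-fixed []              = refl
    map-fixed (αx≡x ∷ fixed) = cong₂ _∷_ αx≡x (map-fixed fixed)
    map-α² : ∀ xs → map α (map α xs) ≡ xs
    map-α² []       = refl
    map-α² (x ∷ xs) = cong₂ _∷_ (α² x) (map-α² xs)
    unique : ∀ {ys} → Chain α n ys → length ys ≡ k → ys ≡ final
    unique {ys} ch eq′ with chain-one-sided avoids (proj₁ ch)
    ... | inj₁ weak = weak-unique ch weak eq′
    ... | inj₂ weak = begin
      ys                 ≡⟨ map-α² ys ⟨
      map α (map α ys)   ≡⟨ cong (map α) (weak-unique (chain-map ch)
                              (All.map⁺ (All.map (λ {y} y≤αy → subst (_≤ α y) (sym (α² y)) y≤αy) weak))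
                              (trans (length-map α ys) eq′)) ⟩
      map α final        ≡⟨ map-fixed (All.map proj₂ fixed) ⟩
      final              ∎
      where open ≡-Reasoning

  -- Reading the walk off a unique longest chain

  module _ (avoids : Avoids132 α) {k : ℕ} {longest : List ℕ}
           (unique-longest : UniqueChain α n (suc k) longest) where

    private
      longest-chain = proj₁ unique-longest
      longest-length = proj₁ (proj₂ unique-longest)
      unique = proj₂ (proj₂ unique-longest)

    -- `α` maps the chain to a chain of the same length, hence by uniqueness to the same list, entry
    -- by entry.
    longest-fixed : All (λ x → α x ≡ x) longest
    longest-fixed = go (unique (chain-map longest-chain) (trans (length-map α longest) longest-length))
      where
      go : ∀ {xs} → map α xs ≡ xs → All (λ x → α x ≡ x) xs
      go {[]}     _  = []
      go {x ∷ xs} eq = proj₁ (∷-injective eq) ∷ go (proj₂ (∷-injective eq))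

    chain-take : ∀ m {xs} → Chain α n xs → Chain α n (take m xs)
    chain-take m (chain , xs<n) = AllPairs.take⁺ m chain , All.take⁺ m xs<n

    -- A longer chain would contain two different chains of length suc k.
    chain-length : ∀ {xs} → Chain α n xs → length xs ≤ suc k
    chain-length {[]} _ = z≤n
    chain-length {x ∷ []} _ = s≤s z≤n
    chain-length {x ∷ y ∷ xs} ch@(((x<y , _) ∷ _) ∷ chain , _ ∷ xs<n) with length (y ∷ xs) ≤? k
    ... | yes ≤k = s≤s ≤k
    ... | no ≰k  = contradiction x≡y (<⇒≢ x<y)
      where
      take-length : ∀ zs → suc k ≤ length zs → length (take (suc k) zs) ≡ suc k
      take-length zs le = trans (length-take (suc k) zs) (m≤n⇒m⊓n≡m le)
      x≡y : x ≡ y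
      x≡y = proj₁ (∷-injective (trans
        (unique (chain-take (suc k) ch) (take-length (x ∷ y ∷ xs) (m≤n⇒m≤1+n (≰⇒> ≰k))))
        (sym (unique (chain-take (suc k) (chain , xs<n)) (take-length (y ∷ xs) (≰⇒> ≰k))))))

    Closed : ℕ → ℕ → List ℕ → Set
    Closed l r s = ∀ {x} → Active l r s x → Active l r s (α x)

    -- If `α y < α r` for some `y` on the stack, the positions `l < α y < α r` carry the values
    -- `α l < r < y` in the order `α l`, `y`, `r`: a 132. The strict inequalities hold because `α l`
    -- is not on the stack.
    push-chain : ∀ {l r s} → l ≤ r → Stack (suc r) s → AllPairs (Step α) s → Closed l (suc r) s →
                 ¬ (α l ∈ s) → All (Step α r) s
    push-chain {l} {r} {s} l≤r (_ , r<s) chain closed αl∉s =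
      All.tabulate λ y∈s → All.lookup r<s y∈s , increases y∈s
      where
      l≤αr : l ≤ α r
      l≤αr = proj₁ (closed (l≤r , inj₁ (n<1+n r)))
      αl≤r : α l ≤ r
      αl≤r with closed (≤-refl , inj₁ (s≤s l≤r))
      ... | _ , inj₁ (s≤s αl≤r) = αl≤r
      ... | _ , inj₂ αl∈s       = contradiction αl∈s αl∉s
      increases : ∀ {y} → y ∈ s → α r < α y
      increases {y} y∈s with <-cmp (α r) (α y)
      ... | tri< αr<αy _ _ = αr<αy
      ... | tri≈ _ αr≡αy _ =
        contradiction (trans (sym (α² r)) (trans (cong α αr≡αy) (α² y))) (<⇒≢ (All.lookup r<s y∈s))
      ... | tri> _ _ αy<αr = contradiction (subst₂ _<_ (sym (α² r)) (sym (α² y)) (All.lookup r<s y∈s))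
          (avoids l<αy αy<αr (subst (α l <_) (sym (α² r)) αl<r))
        where
        l≤αy : l ≤ α y
        l≤αy = proj₁ (closed (≤-trans l≤r (<⇒≤ (All.lookup r<s y∈s)) , inj₂ y∈s))
        l<αy : l < α y
        l<αy = ≤∧≢⇒< l≤αy λ { refl → αl∉s (subst (_∈ s) (sym (α² y)) y∈s) }
        αl<r : α l < r
        αl<r = ≤∧≢⇒< αl≤r λ { refl → <⇒≱ αy<αr (subst (_≤ α y) (sym (α² l)) l≤αy) }

    closed-down : ∀ {l r f s} → Stack r (f ∷ s) → α l ≡ f → Closed l r (f ∷ s) → Closed (suc l) r s
    closed-down {l} {r} {f} {s} st αl≡f closed {x} a with active-down (closed (active-down⁻ a))
    ... | bottom αx≡l  =
      contradiction (trans (sym (α² x)) (trans (cong α αx≡l) αl≡f)) (active-down-≢ st a)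
    ... | partner αx≡f =
      contradiction (sym (trans (sym (α² x)) (trans (cong α (trans αx≡f (sym αl≡f))) (α² l))))
        (<⇒≢ (proj₁ a))
    ... | other a′     = a′

    -- The step at `l` is down if `α l` is the top of the stack and up otherwise. Invariants: the
    -- stack is a chain, `α` preserves the active points, and the longest chain consists of active
    -- points. The last equation places the stopping height at `suc k`.
    decode : ∀ m l {s d} → m + l ≤ n → Stack (m + l) s → Chain α n s → Closed l (m + l) s →
             All (Active l (m + l) s) longest → length s + d ≡ suc k →
             ∃ λ (w : Walk (length s) d m) → Run α l (m + l) s w

    decode-up : ∀ m l {s d} → suc m + l ≤ n → Stack (suc m + l) s → Chain α n s →
                Closed l (suc m + l) s → All (Active l (suc m + l) s) longest → ¬ (α l ∈ s) →
                length s + d ≡ suc k → ∃ λ (w : Walk (length s) d (suc m)) → Run α l (suc m + l) s w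

    decode-down : ∀ m l {f s d} → suc m + l ≤ n → Stack (suc m + l) (f ∷ s) → Chain α n (f ∷ s) →
                  Closed l (suc m + l) (f ∷ s) → All (Active l (suc m + l) (f ∷ s)) longest → α l ≡ f →
                  length (f ∷ s) + d ≡ suc k →
                  ∃ λ (w : Walk (length (f ∷ s)) d (suc m)) → Run α l (suc m + l) (f ∷ s) w

    -- The stack now has `suc k` entries, so it is the longest chain and is fixed pointwise.
    decode zero l {s} {zero} _ _ (chain , s<n) _ _ eq =
      stop , stop (subst (All _) (sym s≡longest) longest-fixed)
      where s≡longest = unique (chain , s<n) (trans (sym (+-identityʳ _)) eq)
    -- The interval is used up, so the longest chain would have to fit into a shorter stack.
    decode zero l {s} {suc d} _ _ _ _ longest-active eq =
      contradiction
        (sorted-⊆-length (chain-sorted (proj₁ longest-chain)) (active-stop ∘ All.lookup longest-active))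
        (<⇒≱ (subst (length s <_) (trans eq (sym longest-length)) (m<m+n _ z<s)))
    decode (suc m) l {[]} l+m<n st ch closed longest-active eq =
      decode-up m l l+m<n st ch closed longest-active (λ ()) eq
    decode (suc m) l {f ∷ s} l+m<n st ch closed longest-active eq with α l ≟ f
    ... | no  αl≢f = decode-up m l l+m<n st ch closed longest-active αl∉ eq
      where
      αl∉ : ¬ (α l ∈ f ∷ s)
      αl∉ (here αl≡f)  = αl≢f αl≡f
      -- If `α l` were deeper in the stack, the chain property would give `α f < α (α l) = l`, below
      -- all active points.
      αl∉ (there αl∈s) =
        <⇒≱ (subst (α f <_) (α² l) (proj₂ (All.lookup (AllPairs.head (proj₁ ch)) αl∈s)))
          (proj₁ (closed (≤-trans (m≤n+m l (suc m)) (All.head (proj₂ st)) , inj₂ (here refl))))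
    ... | yes αl≡f = decode-down m l l+m<n st ch closed longest-active αl≡f eq

    decode-up m l {s} {d} l+m<n st (chain , s<n) closed longest-active αl∉s eq = continue d eq
      where
      pushed : Chain α n (m + l ∷ s)
      pushed = (push-chain (m≤n+m l m) st chain closed αl∉s ∷ chain) , (l+m<n ∷ s<n)
      continue : ∀ d → length s + d ≡ suc k →
                 ∃ λ (w : Walk (length s) d (suc m)) → Run α l (suc m + l) s w
      -- The stack already has `suc k` entries, and the push would make a chain longer than the
      -- longest.
      continue zero    eq = contradiction (trans (sym (+-identityʳ _)) eq) (<⇒≢ (chain-length pushed))
      continue (suc d) eq
        with decode m l (<⇒≤ l+m<n) (stack-up st) pushed (active-up ∘ closed ∘ active-up⁻)
               (All.map active-up longest-active) (trans (sym (+-suc _ d)) eq)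
      ... | w , run = up w , up run

    decode-down m l {f} {s} {d} l+m<n st ch closed longest-active αl≡f eq = continue d eq
      where
      αf≡l : α f ≡ l
      αf≡l = trans (cong α (sym αl≡f)) (α² l)
      l<f : l < f
      l<f = ≤-trans (s≤s (m≤n+m l m)) (All.head (proj₂ st))
      -- The longest chain consists of fixed points, so it misses the 2-cycle of `l` and `f` and
      -- survives the pop.
      still-active : ∀ {x} → Active l (suc m + l) (f ∷ s) x × α x ≡ x → Active (suc l) (suc m + l) s x
      still-active (a , αx≡x) with active-down a
      ... | bottom refl  = contradiction (trans (sym αx≡x) αl≡f) (<⇒≢ l<f)
      ... | partner refl = contradiction (trans (sym αf≡l) αx≡x) (<⇒≢ l<f)
      ... | other a′     = a′
      ResultAt : ℕ → ℕ → Set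
      ResultAt d r = ∃ λ (w : Walk (length s) (suc (suc d)) m) → Run α (suc l) r s w
      rest : ∀ d → length (f ∷ s) + suc d ≡ suc k → ResultAt d (suc m + l)
      rest d eq = subst (ResultAt d) (+-suc m l)
        (decode m (suc l) (subst (_≤ n) (sym (+-suc m l)) l+m<n)
          (subst (λ r → Stack r s) (sym (+-suc m l)) (stack-down st))
          (AllPairs.tail (proj₁ ch) , All.tail (proj₂ ch))
          (subst (λ r → Closed (suc l) r s) (sym (+-suc m l)) (closed-down st αl≡f closed))
          (subst (λ r → All (Active (suc l) r s) longest) (sym (+-suc m l))
            (All.zipWith still-active (longest-active , longest-fixed)))
          (trans (+-suc _ (suc d)) eq))
      continue : ∀ d → length (f ∷ s) + d ≡ suc k →
                 ∃ λ (w : Walk (length (f ∷ s)) d (suc m)) → Run α l (suc m + l) (f ∷ s) w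
      -- At height `suc k` the stack is the longest chain, so `f` would be fixed although
      -- `α f = l < f`.
      continue zero eq = contradiction (trans (sym αf≡l) αf≡f) (<⇒≢ l<f)
        where
        αf≡f : α f ≡ f
        αf≡f = All.lookup longest-fixed
                 (subst (f ∈_) (unique ch (trans (sym (+-identityʳ _)) eq)) (here refl))
      continue (suc d) eq = down (proj₁ (rest d eq)) , down αl≡f αf≡l (proj₂ (rest d eq))

    unique-chain⇒run : ∃ λ (w : Walk 0 (suc k) n) → Run α 0 n [] w
    unique-chain⇒run = subst (λ r → ∃ λ (w : Walk 0 (suc k) n) → Run α 0 r [] w) (+-identityʳ n)
      (decode n 0 (≤-reflexive (+-identityʳ n)) ([] , []) ([] , []) closed
        (All.map (λ x<n → z≤n , inj₁ (<n+0 x<n)) (proj₂ longest-chain)) refl)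
      where
      <n+0 : ∀ {x} → x < n → x < n + 0
      <n+0 {x} = subst (x <_) (sym (+-identityʳ n))
      closed : Closed 0 (n + 0) []
      closed {x} (_ , inj₁ x<n) = z≤n , inj₁ (<n+0 (α< (subst (x <_) (+-identityʳ n) x<n)))

-- Counting permutations

module _ {A : Set} {P : A → Set} (P? : Decidable P) {xs : List A} where

  filter-empty⁻ : length (filter P? xs) ≡ 0 → ∀ {x} → x ∈ xs → ¬ P x
  filter-empty⁻ eq x∈xs px with filter P? xs | ∈-filter⁺ P? x∈xs px
  filter-empty⁻ () x∈xs px | _ ∷ _ | _

  filter-empty⁺ : (∀ x → ¬ P x) → length (filter P? xs) ≡ 0
  filter-empty⁺ ¬p = cong length (filter-none P? {xs} (All.universal ¬p xs))

  filter-singleton⁻ : length (filter P? xs) ≡ 1 →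
                      ∃ λ x → P x × (∀ {y} → y ∈ xs → P y → y ≡ x)
  filter-singleton⁻ eq = singleton (filter P? xs) refl eq
    where
    singleton : ∀ ys → ys ≡ filter P? xs → length ys ≡ 1 →
                ∃ λ x → P x × (∀ {y} → y ∈ xs → P y → y ≡ x)
    singleton (x ∷ []) eq′ refl =
      x , proj₂ (∈-filter⁻ P? {xs = xs} (subst (x ∈_) eq′ (here refl))) ,
      λ y∈xs py → only (subst (_ ∈_) (sym eq′) (∈-filter⁺ P? y∈xs py))
      where
      only : ∀ {y} → y ∈ x ∷ [] → y ≡ x
      only (here y≡x) = y≡x

  filter-singleton⁺ : Unique xs → ∀ {x} → x ∈ xs → P x → (∀ {y} → P y → y ≡ x) →
                      length (filter P? xs) ≡ 1
  filter-singleton⁺ xs! {x} x∈xs px only =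
    singleton (filter P? xs) (∈-filter⁺ P? x∈xs px) (Unique.filter⁺ P? xs!) (All.all-filter P? xs)
    where
    singleton : ∀ ys → x ∈ ys → Unique ys → All P ys → length ys ≡ 1
    singleton (y ∷ [])     _ _ _ = refl
    singleton (y ∷ z ∷ ys) _ ((y≢z ∷ _) ∷ _) (py ∷ pz ∷ _) =
      contradiction (trans (only py) (sym (only pz))) y≢z

-- Permutations as functions on ℕ, occurrences as chains

module _ {n : ℕ} where

  ⟦_⟧ : Permutation′ n → ℕ → ℕ
  ⟦ π ⟧ x with x <? n
  ... | yes x<n = toℕ (π ⟨$⟩ʳ fromℕ< x<n)
  ... | no  _   = x

  ⟦⟧-toℕ : ∀ π i → ⟦ π ⟧ (toℕ i) ≡ toℕ (π ⟨$⟩ʳ i)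
  ⟦⟧-toℕ π i with toℕ i <? n
  ... | yes i<n = cong (toℕ ∘ (π ⟨$⟩ʳ_)) (Fin.fromℕ<-toℕ i i<n)
  ... | no  i≮n = contradiction (Fin.toℕ<n i) i≮n

  ⟦⟧-fromℕ< : ∀ π {x} (x<n : x < n) → ⟦ π ⟧ x ≡ toℕ (π ⟨$⟩ʳ fromℕ< x<n)
  ⟦⟧-fromℕ< π {x} x<n = trans (cong ⟦ π ⟧ (sym (Fin.toℕ-fromℕ< x<n))) (⟦⟧-toℕ π (fromℕ< x<n))

  ⟦⟧-outside : ∀ π {x} → n ≤ x → ⟦ π ⟧ x ≡ x
  ⟦⟧-outside π {x} n≤x with x <? n
  ... | yes x<n = contradiction n≤x (<⇒≱ x<n)
  ... | no  _   = refl

  ⟦⟧-bounded : ∀ π {x} → x < n → ⟦ π ⟧ x < n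
  ⟦⟧-bounded π x<n = subst (_< n) (sym (⟦⟧-fromℕ< π x<n)) (Fin.toℕ<n _)

  ⟦⟧-involutive : ∀ π → Involution π → ∀ x → ⟦ π ⟧ (⟦ π ⟧ x) ≡ x
  ⟦⟧-involutive π inv x with x <? n
  ... | no  x≮n = ⟦⟧-outside π (≮⇒≥ x≮n)
  ... | yes x<n = begin
    ⟦ π ⟧ (toℕ (π ⟨$⟩ʳ i))   ≡⟨ ⟦⟧-toℕ π _ ⟩
    toℕ (π ⟨$⟩ʳ (π ⟨$⟩ʳ i))  ≡⟨ cong (toℕ ∘ (π ⟨$⟩ʳ_)) (inv i) ⟩
    toℕ (π ⟨$⟩ʳ (π ⟨$⟩ˡ i))  ≡⟨ cong toℕ (inverseʳ π) ⟩
    toℕ i                    ≡⟨ Fin.toℕ-fromℕ< x<n ⟩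
    x                        ∎
    where open ≡-Reasoning
          i = fromℕ< x<n

  involution-⟦⟧ : ∀ π → (∀ {x} → x < n → ⟦ π ⟧ (⟦ π ⟧ x) ≡ x) → Involution π
  involution-⟦⟧ π inv i = begin
    π ⟨$⟩ʳ i                     ≡⟨ inverseˡ π ⟨
    π ⟨$⟩ˡ (π ⟨$⟩ʳ (π ⟨$⟩ʳ i))   ≡⟨ cong (π ⟨$⟩ˡ_) (Fin.toℕ-injective (begin
      toℕ (π ⟨$⟩ʳ (π ⟨$⟩ʳ i))      ≡⟨ ⟦⟧-toℕ π _ ⟨
      ⟦ π ⟧ (toℕ (π ⟨$⟩ʳ i))       ≡⟨ cong ⟦ π ⟧ (⟦⟧-toℕ π i) ⟨
      ⟦ π ⟧ (⟦ π ⟧ (toℕ i))        ≡⟨ inv (Fin.toℕ<n i) ⟩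
      toℕ i                        ∎)) ⟩
    π ⟨$⟩ˡ i                     ∎
    where open ≡-Reasoning

  132-occurrence⁺ : ∀ π {i j k : Fin n} → i Fin.< j → j Fin.< k →
    π ⟨$⟩ʳ i Fin.< π ⟨$⟩ʳ k → π ⟨$⟩ʳ k Fin.< π ⟨$⟩ʳ j → Occurrence pattern132 π (i ∷ j ∷ k ∷ [])
  132-occurrence⁺ π {i} {j} {k} i<j j<k πi<πk πk<πj = increasing , isomorphic
    where
    increasing : Increasing (i ∷ j ∷ k ∷ [])
    increasing 0F 1F _ = i<j
    increasing 0F 2F _ = <-trans i<j j<k
    increasing 1F 2F _ = j<k
    increasing 0F 0F ()
    increasing 1F 0F ()
    increasing 1F 1F (s≤s ())
    increasing 2F 0F ()
    increasing 2F 1F (s≤s ())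
    increasing 2F 2F (s≤s (s≤s ()))
    true⇔ : ∀ {A B : Set} → A → B → A ⇔ B
    true⇔ a b = mk⇔ (λ _ → b) (λ _ → a)
    false⇔ : ∀ {A B : Set} → ¬ A → ¬ B → A ⇔ B
    false⇔ ¬a ¬b = mk⇔ (⊥-elim ∘ ¬a) (⊥-elim ∘ ¬b)
    isomorphic : OrderIsomorphic (λ a → π ⟨$⟩ʳ lookup (i ∷ j ∷ k ∷ []) a) (pattern132 ⟨$⟩ʳ_)
    isomorphic 0F 0F = false⇔ (<-irrefl refl) λ ()
    isomorphic 0F 1F = true⇔ (<-trans πi<πk πk<πj) (s≤s z≤n)
    isomorphic 0F 2F = true⇔ πi<πk (s≤s z≤n)
    isomorphic 1F 0F = false⇔ (<-asym (<-trans πi<πk πk<πj)) λ ()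
    isomorphic 1F 1F = false⇔ (<-irrefl refl) (<-irrefl refl)
    isomorphic 1F 2F = false⇔ (<-asym πk<πj) λ { (s≤s ()) }
    isomorphic 2F 0F = false⇔ (<-asym πi<πk) λ ()
    isomorphic 2F 1F = true⇔ πk<πj (s≤s (s≤s z≤n))
    isomorphic 2F 2F = false⇔ (<-irrefl refl) (<-irrefl refl)

  fin : ∀ {x} → x < n → ∃ λ (i : Fin n) → toℕ i ≡ x
  fin x<n = fromℕ< x<n , Fin.toℕ-fromℕ< x<n

  -- ⟦ π ⟧ fixes the points from n on, which therefore exceed all entries to their left and
  -- cannot end a 132.
  avoids-⟦⟧ : ∀ π → Avoids π pattern132 → Avoids132 ⟦ π ⟧
  avoids-⟦⟧ π av {i} {j} {k} i<j j<k πi<πk πk<πj = go (k <? n)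
    where
    go : Dec (k < n) → ⊥
    go (no k≮n) = outside (j <? n)
      where
      k<πj : k < ⟦ π ⟧ j
      k<πj = subst (_< ⟦ π ⟧ j) (⟦⟧-outside π (≮⇒≥ k≮n)) πk<πj
      outside : Dec (j < n) → ⊥
      outside (yes j<n) = k≮n (<-trans k<πj (⟦⟧-bounded π j<n))
      outside (no j≮n)  = <-asym j<k (subst (k <_) (⟦⟧-outside π (≮⇒≥ j≮n)) k<πj)
    go (yes k<n) with fin k<n | fin (<-trans j<k k<n) | fin (<-trans i<j (<-trans j<k k<n))
    ... | k′ , refl | j′ , refl | i′ , refl =
      filter-empty⁻ (occurrence? pattern132 π) av (tuples-complete n 3 (i′ ∷ j′ ∷ k′ ∷ []))
        (132-occurrence⁺ π i<j j<k
          (subst₂ _<_ (⟦⟧-toℕ π i′) (⟦⟧-toℕ π k′) πi<πk) (subst₂ _<_ (⟦⟧-toℕ π k′) (⟦⟧-toℕ π j′) πk<πj))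

  ⟦⟧-avoids : ∀ π →
    (∀ {i j k} → k < n → i < j → j < k → ⟦ π ⟧ i < ⟦ π ⟧ k → ¬ (⟦ π ⟧ k < ⟦ π ⟧ j)) →
    Avoids π pattern132
  ⟦⟧-avoids π av = filter-empty⁺ (occurrence? pattern132 π) {tuples n 3} no-occurrence
    where
    no-occurrence : ∀ is → ¬ Occurrence pattern132 π is
    no-occurrence (i ∷ j ∷ k ∷ []) (increasing , isomorphic) =
      av (Fin.toℕ<n k) (increasing 0F 1F (s≤s z≤n)) (increasing 1F 2F (s≤s (s≤s z≤n)))
        (subst₂ _<_ (sym (⟦⟧-toℕ π i)) (sym (⟦⟧-toℕ π k))
          (Equivalence.from (isomorphic 0F 2F) (s≤s z≤n)))
        (subst₂ _<_ (sym (⟦⟧-toℕ π k)) (sym (⟦⟧-toℕ π j))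
          (Equivalence.from (isomorphic 2F 1F) (s≤s (s≤s z≤n))))

  entries : ∀ {k} → Vec (Fin n) k → List ℕ
  entries []       = []
  entries (i ∷ is) = toℕ i ∷ entries is

  entries-length : ∀ {k} (is : Vec (Fin n) k) → length (entries is) ≡ k
  entries-length []       = refl
  entries-length (i ∷ is) = cong suc (entries-length is)

  entries-injective : ∀ {k} (is js : Vec (Fin n) k) → entries is ≡ entries js → is ≡ js
  entries-injective []       []       _  = refl
  entries-injective (i ∷ is) (j ∷ js) eq =
    cong₂ _∷_ (Fin.toℕ-injective (proj₁ (∷-injective eq)))
              (entries-injective is js (proj₂ (∷-injective eq)))

  entries-bounded : ∀ {k} (is : Vec (Fin n) k) → All (_< n) (entries is)
  entries-bounded []       = []
  entries-bounded (i ∷ is) = Fin.toℕ<n i ∷ entries-bounded is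

  entries-surjective : ∀ {xs} → All (_< n) xs → ∃ λ (is : Vec (Fin n) (length xs)) → entries is ≡ xs
  entries-surjective []           = [] , refl
  entries-surjective (x<n ∷ xs<n) with fin x<n | entries-surjective xs<n
  ... | i , eq | is , eq′ = i ∷ is , cong₂ _∷_ eq eq′

  All-entries⁺ : ∀ {P : ℕ → Set} {k} (is : Vec (Fin n) k) →
                 (∀ a → P (toℕ (lookup is a))) → All P (entries is)
  All-entries⁺ []       p = []
  All-entries⁺ (i ∷ is) p = p zero ∷ All-entries⁺ is (p ∘ suc)

  All-entries⁻ : ∀ {P : ℕ → Set} {k} (is : Vec (Fin n) k) →
                 All P (entries is) → ∀ a → P (toℕ (lookup is a))
  All-entries⁻ (i ∷ is) (p ∷ ps) zero    = p
  All-entries⁻ (i ∷ is) (p ∷ ps) (suc a) = All-entries⁻ is ps a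

  AllPairs-entries⁺ : ∀ {R : ℕ → ℕ → Set} {k} (is : Vec (Fin n) k) →
    (∀ a b → a Fin.< b → R (toℕ (lookup is a)) (toℕ (lookup is b))) → AllPairs R (entries is)
  AllPairs-entries⁺ []       r = []
  AllPairs-entries⁺ (i ∷ is) r =
    All-entries⁺ is (λ b → r zero (suc b) (s≤s z≤n)) ∷
    AllPairs-entries⁺ is λ a b a<b → r (suc a) (suc b) (s≤s a<b)

  AllPairs-entries⁻ : ∀ {R : ℕ → ℕ → Set} {k} (is : Vec (Fin n) k) → AllPairs R (entries is) →
    ∀ a b → a Fin.< b → R (toℕ (lookup is a)) (toℕ (lookup is b))
  AllPairs-entries⁻ (i ∷ is) (r ∷ _)  zero    (suc b) _         = All-entries⁻ is r b
  AllPairs-entries⁻ (i ∷ is) (_ ∷ rs) (suc a) (suc b) (s≤s a<b) = AllPairs-entries⁻ is rs a b a<b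

  occurrence⇒chain : ∀ {k} π (is : Vec (Fin n) k) →
    Occurrence (pattern12⋯ k) π is → Chain ⟦ π ⟧ n (entries is)
  occurrence⇒chain π is (increasing , isomorphic) =
    AllPairs-entries⁺ is (λ a b a<b → increasing a b a<b ,
      subst₂ _<_ (sym (⟦⟧-toℕ π _)) (sym (⟦⟧-toℕ π _)) (Equivalence.from (isomorphic a b) a<b)) ,
    entries-bounded is

  chain⇒occurrence : ∀ {k} π (is : Vec (Fin n) k) →
    Chain ⟦ π ⟧ n (entries is) → Occurrence (pattern12⋯ k) π is
  chain⇒occurrence {k} π is (chain , _) =
    (λ a b a<b → proj₁ (AllPairs-entries⁻ is chain a b a<b)) ,
    λ a b → mk⇔ (reflects a b) (preserves a b)
    where
    preserves : ∀ a b → a Fin.< b → π ⟨$⟩ʳ lookup is a Fin.< π ⟨$⟩ʳ lookup is b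
    preserves a b a<b =
      subst₂ _<_ (⟦⟧-toℕ π _) (⟦⟧-toℕ π _) (proj₂ (AllPairs-entries⁻ is chain a b a<b))
    reflects : ∀ a b → π ⟨$⟩ʳ lookup is a Fin.< π ⟨$⟩ʳ lookup is b → a Fin.< b
    reflects a b πa<πb with Fin.<-cmp a b
    ... | tri< a<b _ _  = a<b
    ... | tri≈ _ refl _ = contradiction πa<πb (<-irrefl refl)
    ... | tri> _ _ b<a  = contradiction πa<πb (<-asym (preserves b a b<a))

  once⇒unique-chain : ∀ k π → ContainsExactlyOnce π (pattern12⋯ k) → ∃ (UniqueChain ⟦ π ⟧ n k)
  once⇒unique-chain k π once with filter-singleton⁻ (occurrence? (pattern12⋯ k) π) {tuples n k} once
  ... | is , occ , only = entries is , occurrence⇒chain π is occ , entries-length is , unique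
    where
    unique : ∀ {ys} → Chain ⟦ π ⟧ n ys → length ys ≡ k → ys ≡ entries is
    unique {ys} ch refl with entries-surjective (proj₂ ch)
    ... | js , eq = trans (sym eq) (cong entries (only (tuples-complete n k js)
                      (chain⇒occurrence π js (subst (Chain ⟦ π ⟧ n) (sym eq) ch))))

  unique-chain⇒once : ∀ k π → ∃ (UniqueChain ⟦ π ⟧ n k) → ContainsExactlyOnce π (pattern12⋯ k)
  unique-chain⇒once k π (xs , ch , refl , unique) with entries-surjective (proj₂ ch)
  ... | is , eq = filter-singleton⁺ (occurrence? (pattern12⋯ k) π)
    (tuples-unique n k) (tuples-complete n k is)
    (chain⇒occurrence π is (subst (Chain ⟦ π ⟧ n) (sym eq) ch))
    λ {js} occ → entries-injective js is
      (trans (unique (occurrence⇒chain π js occ) (entries-length js)) (sym eq))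

  Encodes : ∀ {k} → Permutation′ n → Walk 0 k n → Set
  Encodes π w = Run ⟦ π ⟧ 0 n [] w

  counted⇒encoded : ∀ {k} π → Counted (suc k) π → ∃ λ (w : Walk 0 (suc k) n) → Encodes π w
  counted⇒encoded {k} π (inv , av , once) with once⇒unique-chain (suc k) π once
  ... | xs , unique =
    unique-chain⇒run (⟦⟧-involutive π inv) (⟦⟧-bounded π) (avoids-⟦⟧ π av) unique

  encoded⇒counted : ∀ {k} π {w : Walk 0 k n} → Encodes π w → Counted k π
  encoded⇒counted {k} π run = inv , av , unique-chain⇒once k π
      (run⇒unique-chain (⟦⟧-involutive π inv) (⟦⟧-bounded π) (avoids-⟦⟧ π av) run)
    where
    active : ∀ {x} → x < n → Active 0 n [] x
    active x<n = z≤n , inj₁ x<n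
    inv : Involution π
    inv = involution-⟦⟧ π (run-involutive run ∘ active)
    av : Avoids π pattern132
    av = ⟦⟧-avoids π λ k<n i<j j<k → run-avoids ([] , []) run
           (active (<-trans i<j (<-trans j<k k<n))) (active (<-trans j<k k<n)) (active k<n) i<j j<k

  open SetoidMembership (permutationSetoid n) using () renaming (_∈_ to _∈ₚ_)

  -- The function built from the walk is an involution of `[0,n)` and so gives a permutation `ρ`.
  -- The enumeration contains `ρ` only up to pointwise equality, so the run is carried over to the
  -- listed representative.
  encoded-exists : ∀ {k} (w : Walk 0 k n) → ∃ λ π → π ∈ permutations n × Encodes π w
  encoded-exists w = representative (permutations-complete n ρ)
    where
    built : ∃ λ α → Run α 0 n [] w
    built = subst (λ r → ∃ λ α → Run α 0 r [] w) (+-identityʳ n) (run-exists 0 [] w ([] , []))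
    α = proj₁ built
    run = proj₂ built
    active : ∀ {x} → x < n → Active 0 n [] x
    active x<n = z≤n , inj₁ x<n
    bounded : ∀ i → α (toℕ i) < n
    bounded i with run-closed ([] , []) run (active (Fin.toℕ<n i))
    ... | _ , inj₁ αi<n = αi<n
    to : Fin n → Fin n
    to i = fromℕ< (bounded i)
    to-involutive : ∀ i → to (to i) ≡ i
    to-involutive i = Fin.toℕ-injective (begin
      toℕ (to (to i))  ≡⟨ Fin.toℕ-fromℕ< _ ⟩
      α (toℕ (to i))   ≡⟨ cong α (Fin.toℕ-fromℕ< _) ⟩
      α (α (toℕ i))    ≡⟨ run-involutive run (active (Fin.toℕ<n i)) ⟩
      toℕ i            ∎)
      where open ≡-Reasoning
    ρ : Permutation′ n
    ρ = permutation to to to-involutive to-involutive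
    representative : ∀ {πs} → ρ ∈ₚ πs → ∃ λ π → π ∈ πs × Encodes π w
    representative {π ∷ _} (here ρ≈π) = π , here refl , run-cong ([] , []) agree run
      where
      agree : ∀ {x} → Active 0 n [] x → α x ≡ ⟦ π ⟧ x
      agree (_ , inj₁ x<n) with fin x<n
      ... | i , refl = trans (sym (Fin.toℕ-fromℕ< _)) (trans (cong toℕ (ρ≈π i)) (sym (⟦⟧-toℕ π i)))
    representative (there ρ∈) with representative ρ∈
    ... | π , π∈ , enc = π , there π∈ , enc

-- Both inequalities come from the relation `Encodes`: a walk determines its permutation pointwise
-- by `run-agree`, and a permutation determines its walk by `run-unique`.
I¹-walks : ∀ k n → I¹ (suc k) n ≡ length (walks 0 (suc k) n)
I¹-walks k n = ≤-antisym
  (length-≤-separating Encodes separate-permutations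
    (AllPairs.filter⁺ (counted? (suc k)) (permutations-unique n)) λ π∈ →
      let w , enc = counted⇒encoded _ (proj₂ (∈-filter⁻ (counted? (suc k)) {xs = permutations n} π∈))
      in w , walks-complete w , enc)
  (length-≤-separating (λ w π → Encodes π w)
    (λ w≢w′ enc enc′ → w≢w′ (run-unique ([] , []) enc enc′))
    (walks-unique 0 (suc k) n) λ {w} _ →
      let π , π∈ , enc = encoded-exists w
      in π , ∈-filter⁺ (counted? (suc k)) π∈ (encoded⇒counted π enc) , enc)
  where
  separate-permutations : ∀ {π π′ : Permutation′ n} {w : Walk 0 (suc k) n} →
    ¬ (∀ i → π ⟨$⟩ʳ i ≡ π′ ⟨$⟩ʳ i) → Encodes π w → ¬ Encodes π′ w
  separate-permutations {π} {π′} π≉π′ enc enc′ = π≉π′ λ i → Fin.toℕ-injective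
    (trans (sym (⟦⟧-toℕ π i)) (trans (run-agree enc enc′ (z≤n , inj₁ (Fin.toℕ<n i))) (⟦⟧-toℕ π′ i)))

-- Power series

-- Proved on unnormalised rationals, because the gcd reduction in `ℚ./` does not compute on
-- variables.
/1-homo-+ : ∀ a b → + (a + b) ℚ./ 1 ≡ + a ℚ./ 1 ℚ.+ + b ℚ./ 1
/1-homo-+ a b = ℚ.toℚᵘ-injective (begin
  ℚ.toℚᵘ (+ (a + b) ℚ./ 1)
    ≈⟨ ℚ.toℚᵘ-fromℚᵘ (ℚᵘ.mkℚᵘ (+ (a + b)) 0) ⟩
  ℚᵘ.mkℚᵘ (+ (a + b)) 0
    ≈⟨ ℚᵘ.*≡* (cong (ℤ._* + 1)
         (cong₂ ℤ._+_ (sym (ℤ.*-identityʳ (+ a))) (sym (ℤ.*-identityʳ (+ b))))) ⟩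
  ℚᵘ.mkℚᵘ (+ a) 0 ℚᵘ.+ ℚᵘ.mkℚᵘ (+ b) 0
    ≈⟨ ℚᵘ.+-cong (ℚ.toℚᵘ-fromℚᵘ (ℚᵘ.mkℚᵘ (+ a) 0)) (ℚ.toℚᵘ-fromℚᵘ (ℚᵘ.mkℚᵘ (+ b) 0)) ⟨
  ℚ.toℚᵘ (+ a ℚ./ 1) ℚᵘ.+ ℚ.toℚᵘ (+ b ℚ./ 1)
    ≈⟨ ℚ.toℚᵘ-homo-+ (+ a ℚ./ 1) (+ b ℚ./ 1) ⟨
  ℚ.toℚᵘ (+ a ℚ./ 1 ℚ.+ + b ℚ./ 1) ∎)
  where open ℚᵘ.≃-Reasoning

shift-cong : ∀ m {f g} → f ≗ g → shift m f ≗ shift m g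
shift-cong zero    f≗g n       = f≗g n
shift-cong (suc m) f≗g zero    = refl
shift-cong (suc m) f≗g (suc n) = shift-cong m f≗g n

shift-+ : ∀ a b f → shift (a + b) f ≗ shift a (shift b f)
shift-+ zero    b f n       = refl
shift-+ (suc a) b f zero    = refl
shift-+ (suc a) b f (suc n) = shift-+ a b f n

shift-homo-+ : ∀ m f g n → shift m (λ i → f i ℚ.+ g i) n ≡ shift m f n ℚ.+ shift m g n
shift-homo-+ zero    f g n       = refl
shift-homo-+ (suc m) f g zero    = refl
shift-homo-+ (suc m) f g (suc n) = shift-homo-+ m f g n

shift-neg : ∀ m f n → shift m (λ i → ℚ.- f i) n ≡ ℚ.- shift m f n
shift-neg zero    f n       = refl
shift-neg (suc m) f zero    = refl
shift-neg (suc m) f (suc n) = shift-neg m f n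

-- By computation `(f ⋆ g) (suc n)` is `f 0 ℚ.* g (suc n)` plus `((f ∘ suc) ⋆ g) n`. This recursion,
-- with `f` varying, drives the inductions on `⋆` below.
⋆-cong : ∀ {f f′ g g′} → f ≗ f′ → g ≗ g′ → f ⋆ g ≗ f′ ⋆ g′
⋆-cong p q zero    = cong₂ (λ a b → a ℚ.* b ℚ.+ 0ℚ) (p 0) (q 0)
⋆-cong p q (suc n) = cong₂ ℚ._+_ (cong₂ ℚ._*_ (p 0) (q (suc n))) (⋆-cong (p ∘ suc) q n)

⋆-distribˡ-+ : ∀ f g h n → (f ⋆ (λ i → g i ℚ.+ h i)) n ≡ (f ⋆ g) n ℚ.+ (f ⋆ h) n
⋆-distribˡ-+ f g h zero    =
  solve 3 (λ f g h → f :* (g :+ h) :+ con 0ℚ := (f :* g :+ con 0ℚ) :+ (f :* h :+ con 0ℚ)) refl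
    (f 0) (g 0) (h 0)
  where open +-*-Solver
⋆-distribˡ-+ f g h (suc n) = trans
  (cong (f 0 ℚ.* (g (suc n) ℚ.+ h (suc n)) ℚ.+_) (⋆-distribˡ-+ (f ∘ suc) g h n))
  (solve 5 (λ f g h a b → f :* (g :+ h) :+ (a :+ b) := (f :* g :+ a) :+ (f :* h :+ b)) refl
    (f 0) (g (suc n)) (h (suc n)) (((f ∘ suc) ⋆ g) n) (((f ∘ suc) ⋆ h) n))
  where open +-*-Solver

⋆-neg : ∀ f g n → (f ⋆ (λ i → ℚ.- g i)) n ≡ ℚ.- (f ⋆ g) n
⋆-neg f g zero    = solve 2 (λ f g → f :* (:- g) :+ con 0ℚ := :- (f :* g :+ con 0ℚ)) refl (f 0) (g 0)
  where open +-*-Solver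
⋆-neg f g (suc n) = trans (cong (f 0 ℚ.* (ℚ.- g (suc n)) ℚ.+_) (⋆-neg (f ∘ suc) g n))
  (solve 3 (λ f g a → f :* (:- g) :+ :- a := :- (f :* g :+ a)) refl
    (f 0) (g (suc n)) (((f ∘ suc) ⋆ g) n))
  where open +-*-Solver

⋆-shift₁ : ∀ f g → f ⋆ shift 1 g ≗ shift 1 (f ⋆ g)
⋆-shift₁ f g zero          = solve 1 (λ f → f :* con 0ℚ :+ con 0ℚ := con 0ℚ) refl (f 0)
  where open +-*-Solver
⋆-shift₁ f g (suc zero)    = cong (f 0 ℚ.* g 0 ℚ.+_) (⋆-shift₁ (f ∘ suc) g zero)
⋆-shift₁ f g (suc (suc n)) = cong (f 0 ℚ.* g (suc n) ℚ.+_) (⋆-shift₁ (f ∘ suc) g (suc n))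

⋆-shift : ∀ m f g → f ⋆ shift m g ≗ shift m (f ⋆ g)
⋆-shift zero    f g n = refl
⋆-shift (suc m) f g n = begin
  (f ⋆ shift (suc m) g) n        ≡⟨ ⋆-cong {f} (λ _ → refl) (shift-+ 1 m g) n ⟩
  (f ⋆ shift 1 (shift m g)) n    ≡⟨ ⋆-shift₁ f (shift m g) n ⟩
  shift 1 (f ⋆ shift m g) n      ≡⟨ shift-cong 1 (⋆-shift m f g) n ⟩
  shift 1 (shift m (f ⋆ g)) n    ≡⟨ shift-+ 1 m (f ⋆ g) n ⟨
  shift (suc m) (f ⋆ g) n        ∎
  where open ≡-Reasoning

0⋆ : ∀ {f} g → (∀ n → f n ≡ 0ℚ) → ∀ n → (f ⋆ g) n ≡ 0ℚ
0⋆ g f≗0 zero    =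
  trans (cong (λ a → a ℚ.* g 0 ℚ.+ 0ℚ) (f≗0 0)) (trans (ℚ.+-identityʳ _) (ℚ.*-zeroˡ (g 0)))
0⋆ g f≗0 (suc n) =
  trans (cong₂ (λ a b → a ℚ.* g (suc n) ℚ.+ b) (f≗0 0) (0⋆ g (f≗0 ∘ suc) n))
    (trans (ℚ.+-identityʳ _) (ℚ.*-zeroˡ (g (suc n))))

1⋆ : ∀ g → constant 1ℚ ⋆ g ≗ g
1⋆ g zero    = trans (ℚ.+-identityʳ _) (ℚ.*-identityˡ (g 0))
1⋆ g (suc n) = trans (cong₂ ℚ._+_ (ℚ.*-identityˡ (g (suc n))) (0⋆ g (λ _ → refl) n)) (ℚ.+-identityʳ _)

⋆1 : ∀ f → f ⋆ constant 1ℚ ≗ f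
⋆1 f zero    = trans (ℚ.+-identityʳ _) (ℚ.*-identityʳ _)
⋆1 f (suc n) = trans (cong₂ ℚ._+_ (ℚ.*-zeroʳ (f 0)) (⋆1 (f ∘ suc) n)) (ℚ.+-identityˡ _)

-- Chebyshev polynomials at 1/(2x) and walk series

U : ℕ → LaurentSeries
U r = chebyshevU laurentRawRing r 1/2x

2·1/2x : LaurentSeries
2·1/2x = (Laurent.1# Laurent.+ Laurent.1#) Laurent.* 1/2x

-- Together with the pole 1 of `2·1/2x`, this says that 2 · 1/(2x) is 1/x.
2·1/2x-series : series 2·1/2x ≗ constant 1ℚ
2·1/2x-series n = trans (⋆-cong {g = constant ½} two (λ _ → refl) n) (lemma n)
  where
  2ℚ = 1ℚ ℚ.+ 1ℚ
  two : series (Laurent.1# Laurent.+ Laurent.1#) ≗ constant 2ℚ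
  two zero    = refl
  two (suc _) = refl
  lemma : constant 2ℚ ⋆ constant ½ ≗ constant 1ℚ
  lemma zero    = refl
  lemma (suc n) = cong (0ℚ ℚ.+_) (0⋆ (constant ½) (λ _ → refl) n)

walkSeries : ℕ → ℕ → PowerSeries
walkSeries h d n = + length (walks h d n) ℚ./ 1

walkSeries-end : ∀ h → walkSeries h 0 ≗ constant 1ℚ
walkSeries-end h zero    = refl
walkSeries-end h (suc n) = refl

walkSeries-bottom : ∀ d → walkSeries 0 (suc d) ≗ shift 1 (walkSeries 1 d)
walkSeries-bottom d zero    = refl
walkSeries-bottom d (suc n) = cong (λ l → + l ℚ./ 1) (length-map up (walks 1 d n))

walkSeries-middle : ∀ h d → walkSeries (suc h) (suc d) ≗
  shift 1 (λ n → walkSeries (suc (suc h)) d n ℚ.+ walkSeries h (suc (suc d)) n)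
walkSeries-middle h d zero    = refl
walkSeries-middle h d (suc n) = trans
  (cong (λ l → + l ℚ./ 1) (trans (length-++ (map up (walks (suc (suc h)) d n)))
    (cong₂ _+_ (length-map up (walks (suc (suc h)) d n)) (length-map down (walks h (suc (suc d)) n)))))
  (/1-homo-+ (length (walks (suc (suc h)) d n)) (length (walks h (suc (suc d)) n)))

-- Splitting walks by their first step gives g₂ = g₁/x - g₀, which is the Chebyshev recurrence at
-- 1/(2x). The shifts by `p₀` and `suc p₁` arise because Laurent addition brings both summands to
-- the pole `suc q`.
walkSeries-U-step : ∀ g h d →
  g ⋆ series (U h) ≗ shift (pole (U h)) (walkSeries h (suc (suc d))) →
  g ⋆ series (U (suc h)) ≗ shift (pole (U (suc h))) (walkSeries (suc h) (suc d)) →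
  g ⋆ series (U (suc (suc h))) ≗ shift (pole (U (suc (suc h)))) (walkSeries (suc (suc h)) d)
walkSeries-U-step g h d hyp₀ hyp₁ n = begin
  (g ⋆ (λ i → shift p₀ (series 2·1/2x ⋆ u₁) i ℚ.+ shift (suc p₁) (λ j → ℚ.- u₀ j) i)) n
    ≡⟨ ⋆-distribˡ-+ g (shift p₀ (series 2·1/2x ⋆ u₁)) (shift (suc p₁) (λ j → ℚ.- u₀ j)) n ⟩
  (g ⋆ shift p₀ (series 2·1/2x ⋆ u₁)) n ℚ.+ (g ⋆ shift (suc p₁) (λ j → ℚ.- u₀ j)) n
    ≡⟨ cong₂ ℚ._+_ (trans (⋆-shift p₀ g _ n) (shift-cong p₀ left n))
                   (trans (⋆-shift (suc p₁) g _ n) (shift-cong (suc p₁) right n)) ⟩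
  shift p₀ (shift p₁ g₁) n ℚ.+ shift (suc p₁) (λ i → ℚ.- shift p₀ g₀ i) n
    ≡⟨ cong₂ ℚ._+_ first second ⟩
  (shift (suc q) g₂ n ℚ.+ shift (suc q) g₀ n) ℚ.+ ℚ.- shift (suc q) g₀ n
    ≡⟨ solve 2 (λ a b → (a :+ b) :+ :- b := a) refl (shift (suc q) g₂ n) (shift (suc q) g₀ n) ⟩
  shift (suc q) g₂ n ∎
  where
  open ≡-Reasoning
  open +-*-Solver
  g₀ = walkSeries h (suc (suc d))
  g₁ = walkSeries (suc h) (suc d)
  g₂ = walkSeries (suc (suc h)) d
  p₀ = pole (U h)
  p₁ = pole (U (suc h))
  q = p₁ + p₀
  u₀ = series (U h)
  u₁ = series (U (suc h))
  left : g ⋆ (series 2·1/2x ⋆ u₁) ≗ shift p₁ g₁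
  left m = begin
    (g ⋆ (series 2·1/2x ⋆ u₁)) m
      ≡⟨ ⋆-cong {g} (λ _ → refl)
           (λ i → trans (⋆-cong {g = u₁} 2·1/2x-series (λ _ → refl) i) (1⋆ u₁ i)) m ⟩
    (g ⋆ u₁) m
      ≡⟨ hyp₁ m ⟩
    shift p₁ g₁ m ∎
  right : g ⋆ (λ j → ℚ.- u₀ j) ≗ (λ i → ℚ.- shift p₀ g₀ i)
  right m = trans (⋆-neg g u₀ m)
    (cong ℚ.-_ (hyp₀ m))
  -- Expanding g₁ = x · (g₂ + g₀) yields the extra factor x that turns `q` into `suc q`; the g₀ term
  -- then cancels against `second`.
  first : shift p₀ (shift p₁ g₁) n ≡ shift (suc q) g₂ n ℚ.+ shift (suc q) g₀ n
  first = begin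
    shift p₀ (shift p₁ g₁) n                                 ≡⟨ shift-+ p₀ p₁ g₁ n ⟨
    shift (p₀ + p₁) g₁ n                                     ≡⟨ cong (λ m → shift m g₁ n) (+-comm p₀ p₁) ⟩
    shift q g₁ n                                             ≡⟨ shift-cong q (walkSeries-middle h d) n ⟩
    shift q (shift 1 (λ i → g₂ i ℚ.+ g₀ i)) n                ≡⟨ shift-+ q 1 _ n ⟨
    shift (q + 1) (λ i → g₂ i ℚ.+ g₀ i) n                    ≡⟨ cong (λ m → shift m (λ i → g₂ i ℚ.+ g₀ i) n) (+-comm q 1) ⟩
    shift (suc q) (λ i → g₂ i ℚ.+ g₀ i) n                    ≡⟨ shift-homo-+ (suc q) g₂ g₀ n ⟩
    shift (suc q) g₂ n ℚ.+ shift (suc q) g₀ n                ∎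
  second : shift (suc p₁) (λ i → ℚ.- shift p₀ g₀ i) n ≡ ℚ.- shift (suc q) g₀ n
  second = trans (shift-neg (suc p₁) (shift p₀ g₀) n) (cong ℚ.-_ (sym (shift-+ (suc p₁) p₀ g₀ n)))

-- The relation g h = U_h(1/(2x)) · g 0 with its denominator cleared. The power is `pole (U h)`, not
-- `h`: the poles of these representations add up along the recurrence.
walkSeries-U : ∀ h d {k} → h + d ≡ k →
  walkSeries 0 k ⋆ series (U h) ≗ shift (pole (U h)) (walkSeries h d)
walkSeries-U zero d refl n = ⋆1 (walkSeries 0 d) n
walkSeries-U (suc zero) d refl n = begin
  (walkSeries 0 (suc d) ⋆ series 2·1/2x) n  ≡⟨ ⋆-cong {walkSeries 0 (suc d)} (λ _ → refl) 2·1/2x-series n ⟩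
  (walkSeries 0 (suc d) ⋆ constant 1ℚ) n    ≡⟨ ⋆1 (walkSeries 0 (suc d)) n ⟩
  walkSeries 0 (suc d) n                     ≡⟨ walkSeries-bottom d n ⟩
  shift 1 (walkSeries 1 d) n                 ∎
  where open ≡-Reasoning
walkSeries-U (suc (suc h)) d {k} refl = walkSeries-U-step (walkSeries 0 k) h d
  (walkSeries-U h (suc (suc d)) (trans (+-suc h (suc d)) (cong suc (+-suc h d))))
  (walkSeries-U (suc h) (suc d) (cong suc (+-suc h d)))

shift-above : ∀ p f a → shift p f (p + a) ≡ f a
shift-above zero    f a = refl
shift-above (suc p) f a = shift-above p f a

shift-below : ∀ p f {n} → n < p → shift p f n ≡ 0ℚ
shift-below (suc p) f {zero}  _         = refl
shift-below (suc p) f {suc n} (s≤s n<p) = shift-below p f n<p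

-- The factors x^(-p) and x^p cancel. At a negative exponent the index read from `f` is either
-- negative, where the coefficient is 0 by default, or below `p`, where the shifted series vanishes.
shift-coefficient : ∀ p {f g} → f ≗ shift p g → x^-⟨ p ⟩ f Laurent.≈ fromPowerSeries g
shift-coefficient p {f} {g} eq (+ a) = begin
  f (a + p)           ≡⟨ eq (a + p) ⟩
  shift p g (a + p)   ≡⟨ cong (shift p g) (+-comm a p) ⟩
  shift p g (p + a)   ≡⟨ shift-above p g a ⟩
  g a                 ≡⟨ cong g (+-identityʳ a) ⟨
  g (a + 0)           ∎
  where open ≡-Reasoning
shift-coefficient p {f} {g} eq -[1+ a ] with -[1+ a ] ℤ.+ + p in i+p
... | -[1+ _ ] = refl
... | + n      = trans (eq n) (shift-below p g
  (ℤ.drop‿+<+ (subst (ℤ._< + p) i+p (ℤ.+-monoˡ-< (+ p) (ℤ.-<+ {a} {0})))))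

theorem3p2 : (k : ℕ) → 1 ≤ k →
    fromPowerSeries (I¹-series k) ≈1/ chebyshevU laurentRawRing k 1/2x
theorem3p2 (suc k) _ = shift-coefficient (pole (U (suc k))) λ n → begin
  (I¹-series (suc k) ⋆ series (U (suc k))) n
    ≡⟨ ⋆-cong {g = series (U (suc k))} (λ m → cong (λ l → + l ℚ./ 1) (I¹-walks k m)) (λ _ → refl) n ⟩
  (walkSeries 0 (suc k) ⋆ series (U (suc k))) n
    -- At `h = k` and `d = 0` only the empty walk is left, so the right-hand series is 1.
    ≡⟨ walkSeries-U (suc k) 0 (+-identityʳ (suc k)) n ⟩
  shift (pole (U (suc k))) (walkSeries (suc k) 0) n
    ≡⟨ shift-cong (pole (U (suc k))) (walkSeries-end (suc k)) n ⟩
  shift (pole (U (suc k))) (constant 1ℚ) n ∎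
  where open ≡-Reasoning
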